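{- Let $\mathcal{P}$ be the set of integer partitions in which none of $1+1$, $1+2+3$, $2+2+3$ occurs as a sub-partition and in which, for every positive integer $i$, none of the following occurs as a sub-partition: $i+i+i$; $i+(i+1)+(i+1)$; $i+i+(i+1)+(i+2)$; $i+(i+1)+(i+2)+(i+3)$; $i+i+(i+2)+(i+2)+(i+3)$. Then, as formal power series in $x,q$, writing $M=i+2j+3k+4l$ and $L=2l^2+2i+3j+4k+6l$, $$\sum_{\pi\in\mathcal{P}}x^{\ell(\pi)}q^{|\pi|}=\sum_{i,j,k,l\ge 0}(-1)^l\,\frac{x^{M}q^{\frac{M(M-1)}{2}+L}+x^{M+1}q^{\frac{(M+1)M}{2}+L+1}+x^{M+2}q^{\frac{(M+2)(M+1)}{2}+L+2}-x^{M+3}q^{\frac{(M+3)(M+2)}{2}+L+4}}{(q;q)_i\,(q^2;q^2)_j\,(q^3;q^3)_k\,(q^4;q^4)_l}.$$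
   Context: Partitions are finite weakly increasing sequences of positive integers (the empty partition is included); $\ell(\pi)$ is the number of parts and $|\pi|$ the sum of the parts of $\pi$. A sub-partition of a partition is a contiguous portion of it. For $n\ge 0$, $(a;q)_n=\prod_{0\le t<n}(1-aq^t)$. All identities are identities of formal power series. -}

module Defs where

open import Algebra.Definitions.RawMonoid using (sum)
import Algebra.Properties.CommutativeMonoid.Sum as Sum
open import Data.Bool using (if_then_else_; _∧_)
open import Data.Fin using (Fin; zero; suc; toℕ)
open import Data.Integer as ℤ using (ℤ; 0ℤ; 1ℤ; -1ℤ)
import Data.Integer.Properties as ℤ
open import Data.List using (List; []; _∷_; length; foldr; map)
open import Data.List.Membership.Propositional using (_∈_)
open import Data.List.Relation.Binary.Infix.Heterogeneous using (Infix)
open import Data.List.Relation.Unary.All using (All)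
open import Data.List.Relation.Unary.Linked using (Linked)
open import Data.List.Relation.Unary.Unique.Propositional using (Unique)
import Data.Nat.ListAction as ListAction
open import Data.Nat using (ℕ; zero; suc; _+_; _*_; _∸_; _^_; _/_; _≤_; _≟_)
open import Data.Product using (_×_; _,_; ∃)
open import Data.Vec.Functional as Vector using (Vector)
open import Level using (0ℓ)
open import Relation.Binary.PropositionalEquality
open import Relation.Nullary using (¬_)
open import Relation.Nullary.Decidable using (⌊_⌋)
open import Relation.Unary using (Pred)

------------------------------------------------------------------------
-- Formal power series in q over ℤ: f n is the coefficient of q^n

ℤ⟦q⟧ : Set
ℤ⟦q⟧ = ℕ → ℤ

infixl 6 _-q_
infixl 7 _*q_
infixr 8 _^q_
infix  9 _⁻¹

∑ : ∀ {n} → Vector ℤ n → ℤ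
∑ = sum ℤ.+-0-rawMonoid

1q : ℤ⟦q⟧
1q zero    = 1ℤ
1q (suc n) = 0ℤ

q : ℤ⟦q⟧
q 1 = 1ℤ
q _ = 0ℤ

_-q_ : ℤ⟦q⟧ → ℤ⟦q⟧ → ℤ⟦q⟧
(f -q g) n = f n ℤ.- g n

_*q_ : ℤ⟦q⟧ → ℤ⟦q⟧ → ℤ⟦q⟧
(f *q g) n = ∑ {suc n} λ k → f (toℕ k) ℤ.* g (n ∸ toℕ k)

_^q_ : ℤ⟦q⟧ → ℕ → ℤ⟦q⟧
f ^q zero  = 1q
f ^q suc n = f *q f ^q n

-- The inverse of a series with constant term 1 (its value on other
-- series is meaningless), from the recurrence
--   g 0 = 1,   g (n+1) = - ∑_{k ≤ n} f (k+1) g (n-k).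
-- The vector  coeffs f n  lists g (n-1) , … , g 0.

next : ℤ⟦q⟧ → ∀ n → Vector ℤ n → ℤ
next f zero    _ = 1ℤ
next f (suc n) v = ℤ.- ∑ λ k → f (suc (toℕ k)) ℤ.* v k

coeffs : ℤ⟦q⟧ → ∀ n → Vector ℤ n
coeffs f zero    = Vector.[]
coeffs f (suc n) = next f n (coeffs f n) Vector.∷ coeffs f n

_⁻¹ : ℤ⟦q⟧ → ℤ⟦q⟧
(f ⁻¹) n = next f n (coeffs f n)

coeffs-⁻¹ : ∀ f n (k : Fin (suc n)) → coeffs f (suc n) k ≡ (f ⁻¹) (n ∸ toℕ k)
coeffs-⁻¹ f n       zero    = refl
coeffs-⁻¹ f (suc n) (suc k) = coeffs-⁻¹ f n k

*-inverseʳ : ∀ f → f 0 ≡ 1ℤ → f *q f ⁻¹ ≗ 1q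
*-inverseʳ f f0≡1 zero rewrite f0≡1 = refl
*-inverseʳ f f0≡1 (suc n) = begin
  f 0 ℤ.* (f ⁻¹) (suc n) ℤ.+ s   ≡⟨ cong (λ c → c ℤ.* (f ⁻¹) (suc n) ℤ.+ s) f0≡1 ⟩
  1ℤ ℤ.* (f ⁻¹) (suc n) ℤ.+ s    ≡⟨ cong (ℤ._+ s) (ℤ.*-identityˡ ((f ⁻¹) (suc n))) ⟩
  (f ⁻¹) (suc n) ℤ.+ s           ≡⟨ cong (λ t → ℤ.- t ℤ.+ s) eq ⟩
  ℤ.- s ℤ.+ s                    ≡⟨ ℤ.+-inverseˡ s ⟩
  0ℤ                             ∎
  where
  open ≡-Reasoning
  s : ℤ
  s = ∑ {suc n} λ k → f (suc (toℕ k)) ℤ.* (f ⁻¹) (n ∸ toℕ k)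
  eq : ∑ {suc n} (λ k → f (suc (toℕ k)) ℤ.* coeffs f (suc n) k) ≡ s
  eq = Sum.sum-cong-≗ ℤ.+-0-commutativeMonoid {suc n}
         λ k → cong (f (suc (toℕ k)) ℤ.*_) (coeffs-⁻¹ f n k)

-- qPoch a b n = (a;b)_n = ∏_{0≤t<n} (1 - a b^t)
qPoch : ℤ⟦q⟧ → ℤ⟦q⟧ → ℕ → ℤ⟦q⟧
qPoch a b zero    = 1q
qPoch a b (suc n) = qPoch a b n *q (1q -q a *q b ^q n)

------------------------------------------------------------------------
-- Formal power series in x and q over ℤ: f m n is the coefficient of
-- x^m q^n, so f m is the coefficient of x^m in ℤ⟦q⟧⟦x⟧

ℤ⟦x,q⟧ : Set
ℤ⟦x,q⟧ = ℕ → ℤ⟦q⟧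

infix  8 x^_q^_
infixl 7 _/xq_
infixr 7 _·xq_
infixl 6 _+xq_ _-xq_

x^_q^_ : ℕ → ℕ → ℤ⟦x,q⟧
(x^ a q^ b) m n = if ⌊ m ≟ a ⌋ ∧ ⌊ n ≟ b ⌋ then 1ℤ else 0ℤ

_+xq_ : ℤ⟦x,q⟧ → ℤ⟦x,q⟧ → ℤ⟦x,q⟧
(f +xq g) m n = f m n ℤ.+ g m n

_-xq_ : ℤ⟦x,q⟧ → ℤ⟦x,q⟧ → ℤ⟦x,q⟧
(f -xq g) m n = f m n ℤ.- g m n

_·xq_ : ℤ → ℤ⟦x,q⟧ → ℤ⟦x,q⟧
(c ·xq f) m n = c ℤ.* f m n

_/xq_ : ℤ⟦x,q⟧ → ℤ⟦q⟧ → ℤ⟦x,q⟧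
(f /xq g) m = f m *q g ⁻¹

-- HasSum P f s: the family (f i), indexed by the i satisfying P, is
-- summable as a family of formal power series (each coefficient is
-- nonzero for only finitely many i), and its sum is s.
HasSum : {I : Set} → Pred I 0ℓ → (I → ℤ⟦x,q⟧) → ℤ⟦x,q⟧ → Set
HasSum {I} P f s = ∀ m n → ∃ λ is →
    Unique is
  × All P is
  × (∀ i → P i → f i m n ≢ 0ℤ → i ∈ is)
  × foldr ℤ._+_ 0ℤ (map (λ i → f i m n) is) ≡ s m n

------------------------------------------------------------------------
-- Partitions

IsPartition : Pred (List ℕ) 0ℓ
IsPartition π = All (1 ≤_) π × Linked _≤_ π

_isSubPartitionOf_ : List ℕ → List ℕ → Set
_isSubPartitionOf_ = Infix _≡_

data Forbidden : Pred (List ℕ) 0ℓ where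
  1+1   : Forbidden (1 ∷ 1 ∷ [])
  1+2+3 : Forbidden (1 ∷ 2 ∷ 3 ∷ [])
  2+2+3 : Forbidden (2 ∷ 2 ∷ 3 ∷ [])
  i+i+i : ∀ {i} → 1 ≤ i →
    Forbidden (i ∷ i ∷ i ∷ [])
  i+[i+1]+[i+1] : ∀ {i} → 1 ≤ i →
    Forbidden (i ∷ i + 1 ∷ i + 1 ∷ [])
  i+i+[i+1]+[i+2] : ∀ {i} → 1 ≤ i →
    Forbidden (i ∷ i ∷ i + 1 ∷ i + 2 ∷ [])
  i+[i+1]+[i+2]+[i+3] : ∀ {i} → 1 ≤ i →
    Forbidden (i ∷ i + 1 ∷ i + 2 ∷ i + 3 ∷ [])
  i+i+[i+2]+[i+2]+[i+3] : ∀ {i} → 1 ≤ i →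
    Forbidden (i ∷ i ∷ i + 2 ∷ i + 2 ∷ i + 3 ∷ [])

𝒫 : Pred (List ℕ) 0ℓ
𝒫 π = IsPartition π × (∀ ρ → Forbidden ρ → ¬ (ρ isSubPartitionOf π))

weight : List ℕ → ℤ⟦x,q⟧
weight π = x^ length π q^ ListAction.sum π

------------------------------------------------------------------------
-- The summand of the quadruple sum.  The divisions by 2 are exact, and
-- M ∸ 1 only truncates at M = 0, where the product M (M ∸ 1) is 0 anyway.

summand : ℕ × ℕ × ℕ × ℕ → ℤ⟦x,q⟧
summand (i , j , k , l) = (-1ℤ ℤ.^ l) ·xq (numerator /xq denominator)
  where
  M L : ℕ
  M = i + 2 * j + 3 * k + 4 * l
  L = 2 * l ^ 2 + 2 * i + 3 * j + 4 * k + 6 * l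
  numerator : ℤ⟦x,q⟧
  numerator =
         x^ M     q^ (M * (M ∸ 1) / 2 + L)
    +xq  x^ M + 1 q^ ((M + 1) * M / 2 + L + 1)
    +xq  x^ M + 2 q^ ((M + 2) * (M + 1) / 2 + L + 2)
    -xq  x^ M + 3 q^ ((M + 3) * (M + 2) / 2 + L + 4)
  denominator : ℤ⟦q⟧
  denominator =
       qPoch q q i
    *q qPoch (q ^q 2) (q ^q 2) j
    *q qPoch (q ^q 3) (q ^q 3) k
    *q qPoch (q ^q 4) (q ^q 4) l

{-# OPTIONS --safe #-}
-- Idea.  Subtracting 1 from every part of a partition, or removing a part
-- equal to 1, changes the condition "no forbidden sub-partition" only through
-- a finite list of patterns that must not be prefixes.  These lists are the
-- states F of a finite automaton, and the generating functions satisfy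
--
--   G_F(x) = x q G_{place F}(x) + G_{skip F}(x q).
--
-- With σ the substitution x ↦ x q and u the multiplication by x q, eliminating
-- all states except E = σ G_A and V = σ G_D leaves a system with a unique
-- solution.  The operator T, x^n ↦ x^n q^(n(n-1)/2), satisfies
-- u σ T = T u, so for E = T H and V = T Z the dilations attached to x
-- disappear, and H is determined by a first order q-difference equation, solved by
--
--   H = (x⁴q⁸; q⁴)_∞ / ((xq²; q)_∞ (x²q³; q²)_∞ (x³q⁴; q³)_∞).
--
-- Expanding the four factors by Euler's identities gives the quadruple sum; its
-- four numerators come from G_initial = T ((1 + xq + x²q² - x³q⁴) H).

module Submission where

open import Defs
open import Algebra.Bundles using (AbelianGroup; CommutativeRing)
import Algebra.Consequences.Setoid as Consequences
import Algebra.Construct.Pointwise as Pointwise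
import Algebra.Definitions.RawMonoid as RawMonoidDefinitions
import Algebra.Properties.AbelianGroup as AbelianGroupProperties
import Algebra.Properties.CommutativeSemigroup as CommutativeSemigroupProperties
import Algebra.Properties.CommutativeSemiring.Exp as Exp
import Algebra.Properties.Group as GroupProperties
import Algebra.Properties.Ring as RingProperties
import Algebra.Solver.Ring.NaturalCoefficients.Default as Solver
open import Data.Bool using (if_then_else_)
open import Data.Fin using (toℕ)
open import Data.Integer as ℤ using (ℤ; 0ℤ; 1ℤ; -1ℤ)
import Data.Integer.Properties as ℤ
open import Data.List using (List; []; _∷_; _++_; applyUpTo; cartesianProduct; concatMap; foldr; length; map; upTo)
open import Data.List.Membership.Propositional using (_∈_; find; lose)
open import Data.List.Membership.Propositional.Properties using (∈-++⁻; ∈-++⁺ʳ; ∈-++⁺ˡ; ∈-cartesianProduct⁺; ∈-map⁻; ∈-map⁺; ∈-upTo⁺)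
open import Data.List.Properties using (length-++; length-map; map-injective; map-upTo; map-∘; ∷-injectiveʳ; ∷-injectiveˡ)
open import Data.List.Relation.Binary.Infix.Heterogeneous as Infix using (here; there)
import Data.List.Relation.Binary.Infix.Heterogeneous.Properties as Infix
open import Data.List.Relation.Binary.Prefix.Heterogeneous using (Prefix; []; _∷_)
open import Data.List.Relation.Unary.All as All using (All; []; _∷_)
import Data.List.Relation.Unary.All.Properties as All
open import Data.List.Relation.Unary.AllPairs using ([]; _∷_)
open import Data.List.Relation.Unary.Any as Any using (Any; any?; here; there)
import Data.List.Relation.Unary.Any.Properties as Any
open import Data.List.Relation.Unary.Linked as Linked using (Linked; []; [-]; _∷_)
import Data.List.Relation.Unary.Linked.Properties as Linked
open import Data.List.Relation.Unary.Unique.Propositional using (Unique)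
import Data.List.Relation.Unary.Unique.Propositional.Properties as Unique
open import Data.Nat as ℕ using (ℕ; zero; suc; _∸_; _≟_; _≤_; _≤?_; _<_; pred; s<s; s<s⁻¹; s≤s; s≤s⁻¹; z<s; z≤n)
open import Data.Nat.DivMod using (m*n/n≡m)
import Data.Nat.ListAction as ListAction
import Data.Nat.Properties as ℕ
open import Data.Nat.Tactic.RingSolver using (solve-∀)
open import Data.Product using (_×_; _,_; ∃; proj₁; proj₂)
open import Data.Sum using (inj₁; inj₂)
open import Function using (_∘_)
open import Relation.Binary.PropositionalEquality as ≡ using (_≡_; _≢_)
import Relation.Binary.Reasoning.Setoid as SetoidReasoning
open import Relation.Nullary using (Dec; yes; no; ¬_; contradiction)
open import Relation.Nullary.Decidable using (False; True; toWitness; toWitnessFalse; ⌊_⌋)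
open import Relation.Unary using (U)

-- The four factors of H come from two equations. Under T, the operator `Y` becomes multiplication
-- by x³q⁴, so the system reads H = Z + x³q⁴ H and (1 - x²q³) Z = σ((1 + xq + x²q² + x³q³) H).
-- Dilation turns the bracket into 1 + y + y² + y³ with y = xq², which is (1 - x⁴q⁸)/(1 - xq²).
-- Hence (1 - xq²)(1 - x²q³)(1 - x³q⁴) H(x) = (1 - x⁴q⁸) H(xq). T is never inverted: (T H, T Z) is
-- checked to satisfy the system of (σ G_A, σ G_D), and the system fixes all coefficients in x once
-- the constant one of the first unknown is given, because 1 - q^n cancels for n ≥ 1. No infinite
-- product is formed either: each factor is defined by its Euler series and enters only through its
-- first order q-difference equation. The algebra takes place over an abstract commutative ring,
-- with σ and T known by their commutation rules. The solver used there knows semirings only, so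
-- minus signs are moved to the other side or written as a factor -1.

module RingIdentities {c ℓ} (R : CommutativeRing c ℓ) where

  open CommutativeRing R
  open Exp commutativeSemiring using (_^_)
  open GroupProperties +-group using () renaming (∙-cancelʳ to +-cancelʳ)
  open Solver commutativeSemiring using (solve; con; Polynomial; _:=_; _:+_; _:*_)
  open RingProperties ring using (-1*x≈-x)
  open SetoidReasoning setoid

  -- Multiplying y′ - p y′ = y by s′ e′ leaves s′ e′ y, and s′ = - s. This is the coefficient
  -- recurrence of a signed Euler series: s is the sign, e the power of q, y the reciprocal
  -- Pochhammer symbol.
  alternating-step : ∀ {s s′ p y y′ e e′} a b → s′ + s ≈ 0# → y′ ≈ p * y′ + y → e′ ≈ a * (b * e) →
    p * (s′ * (e′ * y′)) ≈ s′ * (e′ * y′) + a * (b * (s * (e * y)))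
  alternating-step {s} {s′} {p} {y} {y′} {e} {e′} a b s′+s y′-eq e′-eq = sym (begin
    s′ * (e′ * y′) + a * (b * (s * (e * y)))
      ≈⟨ +-cong (*-congˡ (*-congˡ y′-eq))
           (solve 5 (λ A B S E Y → A :* (B :* (S :* (E :* Y))) := S :* ((A :* (B :* E)) :* Y)) refl a b s e y) ⟩
    s′ * (e′ * (p * y′ + y)) + s * ((a * (b * e)) * y)
      ≈⟨ +-congˡ (*-congˡ (*-congʳ e′-eq)) ⟨
    s′ * (e′ * (p * y′ + y)) + s * (e′ * y)
      ≈⟨ solve 6 (λ S′ S E P Y Y′ → S′ :* (E :* (P :* Y′ :+ Y)) :+ S :* (E :* Y)
           := P :* (S′ :* (E :* Y′)) :+ (S′ :+ S) :* (E :* Y)) refl s′ s e′ p y y′ ⟩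
    p * (s′ * (e′ * y′)) + (s′ + s) * (e′ * y)
      ≈⟨ +-congˡ (trans (*-congʳ s′+s) (zeroˡ _)) ⟩
    p * (s′ * (e′ * y′)) + 0#
      ≈⟨ +-identityʳ _ ⟩
    p * (s′ * (e′ * y′))
      ∎)

  numerator-expansion : ∀ s ℓ d r w₀ w₁ w₂ w₃ y₀ y₁ y₂ y₃ →
    let a = s * (ℓ * d) in
    s * ((w₀ * ℓ * y₀ + w₁ * (ℓ * r) * y₁ + w₂ * (ℓ * (r * r)) * y₂ - w₃ * (ℓ * (r * (r * (r * r)))) * y₃) * d)
    ≈ w₀ * a * y₀ + (w₁ * (r * a) * y₁ + w₂ * (r * (r * a)) * y₂) + w₃ * (- 1# * (r * (r * (r * (r * a))))) * y₃
  numerator-expansion s ℓ d r w₀ w₁ w₂ w₃ y₀ y₁ y₂ y₃ = trans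
    -- The semiring solver sees `- 1#` as one more variable m.
    (*-congˡ (*-congʳ (+-congˡ (sym (-1*x≈-x _)))))
    (solve 13 (λ s ℓ d r w₀ w₁ w₂ w₃ y₀ y₁ y₂ y₃ m →
      let a = s :* (ℓ :* d) in
      s :* ((w₀ :* ℓ :* y₀ :+ w₁ :* (ℓ :* r) :* y₁ :+ w₂ :* (ℓ :* (r :* r)) :* y₂
               :+ m :* (w₃ :* (ℓ :* (r :* (r :* (r :* r)))) :* y₃)) :* d)
      := w₀ :* a :* y₀ :+ (w₁ :* (r :* a) :* y₁ :+ w₂ :* (r :* (r :* a)) :* y₂)
               :+ w₃ :* (m :* (r :* (r :* (r :* (r :* a))))) :* y₃)
      refl s ℓ d r w₀ w₁ w₂ w₃ y₀ y₁ y₂ y₃ (- 1#))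

  regroup : ∀ e₁ d₁ e₂ d₂ e₃ d₃ s e₄ d₄ →
    e₁ * d₁ * (e₂ * d₂ * (e₃ * d₃ * (s * (e₄ * d₄)))) ≈ s * (e₁ * (e₂ * (e₃ * e₄)) * (d₁ * d₂ * d₃ * d₄))
  regroup = solve 9 (λ e₁ d₁ e₂ d₂ e₃ d₃ s e₄ d₄ →
    e₁ :* d₁ :* (e₂ :* d₂ :* (e₃ :* d₃ :* (s :* (e₄ :* d₄))))
    := s :* (e₁ :* (e₂ :* (e₃ :* e₄)) :* (d₁ :* d₂ :* d₃ :* d₄))) refl

  -- The system of q-difference equations

  module System (x q : Carrier)
    (σ : Carrier → Carrier)
    (σ-cong : ∀ {f g} → f ≈ g → σ f ≈ σ g)
    (σ-+ : ∀ f g → σ (f + g) ≈ σ f + σ g)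
    (σ-q : ∀ f → σ (q * f) ≈ q * σ f)
    (σ-x : ∀ f → σ (x * f) ≈ x * (q * σ f))
    where

    pow : ∀ {n} → Polynomial n → ℕ → Polynomial n
    pow p zero    = con 1
    pow p (suc k) = p :* pow p k

    u : Carrier → Carrier
    u f = x * (q * f)

    u-cong : ∀ {f g} → f ≈ g → u f ≈ u g
    u-cong p = *-congˡ (*-congˡ p)

    -- Applied to σ A, `b₂` and `b₁` give the states `B₂` and `B₁`, and `Y` gives the excess of σ A
    -- over σ D.
    b₂ b₁ Y : Carrier → Carrier
    b₂ f = f + u (σ f)
    b₁ f = f + u (σ (b₂ f))
    Y f  = σ (u (u (σ (u (σ f)))))

    W : Carrier → Carrier → Carrier
    W f v = σ f + (σ (u (σ (b₁ f))) + σ (u (u (σ v))))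

    IsSolution : Carrier → Carrier → Set ℓ
    IsSolution f v = (f ≈ v + Y f) × (v ≈ W f v)

    b₂-cong : ∀ {f g} → f ≈ g → b₂ f ≈ b₂ g
    b₂-cong p = +-cong p (u-cong (σ-cong p))

    -- Multiplication by 1 + xq + x²q² - x³q⁴, the source of the four numerators.
    N : Carrier → Carrier
    N f = f + (u f + u (u f)) + - 1# * (q * u (u (u f)))

    N-cong : ∀ {f g} → f ≈ g → N f ≈ N g
    N-cong p = +-cong (+-cong p (+-cong (u-cong p) (u-cong (u-cong p))))
                      (*-congˡ (*-congˡ (u-cong (u-cong (u-cong p)))))

    N-+ : ∀ f g → N (f + g) ≈ N f + N g
    N-+ f g = solve 5 (λ F G X Q M →
        let U = λ F → X :* (Q :* F)
            N′ = λ F → F :+ (U F :+ U (U F)) :+ M :* (Q :* U (U (U F))) in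
        N′ (F :+ G) := N′ F :+ N′ G)
      refl f g x q (- 1#)

    N-0# : N 0# ≈ 0#
    N-0# = solve 3 (λ X Q M →
        let U = λ F → X :* (Q :* F)
            N′ = λ F → F :+ (U F :+ U (U F)) :+ M :* (Q :* U (U (U F))) in
        N′ (con 0) := con 0)
      refl x q (- 1#)

    module Automaton (A A₁ A₂ B₁ B₁′ B₂ B₂′ B₃ C C′ D D₁ D₂ I : Carrier)
      (A-eq  : A   ≈ u A₁ + σ A)  (A₁-eq : A₁ ≈ u A₂ + σ B₁) (A₂-eq : A₂ ≈ σ C)
      (B₁-eq : B₁  ≈ u B₁′ + σ A) (B₁′-eq : B₁′ ≈ σ B₂)
      (B₂-eq : B₂  ≈ u B₂′ + σ A) (B₂′-eq : B₂′ ≈ σ B₃) (B₃-eq : B₃ ≈ σ A)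
      (C-eq  : C   ≈ u B₂′ + σ D) (C′-eq : C′ ≈ σ D)
      (D-eq  : D   ≈ u D₁ + σ A)  (D₁-eq : D₁ ≈ u D₂ + σ B₁) (D₂-eq : D₂ ≈ σ C′)
      (I-eq  : I   ≈ u B₁′ + σ D)
      where

      B₂′-eq′ : B₂′ ≈ σ (σ A)
      B₂′-eq′ = trans B₂′-eq (σ-cong B₃-eq)

      B₂≈b₂ : B₂ ≈ b₂ (σ A)
      B₂≈b₂ = trans B₂-eq (trans (+-congʳ (u-cong B₂′-eq′)) (+-comm _ _))

      B₁≈b₁ : B₁ ≈ b₁ (σ A)
      B₁≈b₁ = trans B₁-eq (trans (+-congʳ (u-cong (trans B₁′-eq (σ-cong B₂≈b₂)))) (+-comm _ _))

      D≈ : D ≈ u (u (σ (σ D)) + σ B₁) + σ A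
      D≈ = trans D-eq (+-congʳ (u-cong (trans D₁-eq (+-congʳ (u-cong (trans D₂-eq (σ-cong C′-eq)))))))

      -- From `A` and from `D` the same two placements are possible, and the outcomes differ only
      -- afterwards: `C` has the extra term u `B₂′` that `C′` lacks. Carried back through σ and two
      -- u, it is the whole difference.
      A≈ : A ≈ D + u (u (σ (u (σ (σ A)))))
      A≈ = begin
        A
          ≈⟨ A-eq ⟩
        u A₁ + σ A
          ≈⟨ +-congʳ (u-cong (trans A₁-eq (+-congʳ (u-cong (trans A₂-eq
               (trans (σ-cong (trans C-eq (+-congʳ (u-cong B₂′-eq′)))) (σ-+ _ _))))))) ⟩
        u (u (σ (u (σ (σ A))) + σ (σ D)) + σ B₁) + σ A
          ≈⟨ solve 6 (λ X Q P S B E → X :* (Q :* (X :* (Q :* (P :+ S)) :+ B)) :+ E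
               := (X :* (Q :* (X :* (Q :* S) :+ B)) :+ E) :+ X :* (Q :* (X :* (Q :* P))))
               refl x q (σ (u (σ (σ A)))) (σ (σ D)) (σ B₁) (σ A) ⟩
        u (u (σ (σ D)) + σ B₁) + σ A + u (u (σ (u (σ (σ A)))))
          ≈⟨ +-congʳ D≈ ⟨
        D + u (u (σ (u (σ (σ A)))))
          ∎

      isSolution : IsSolution (σ A) (σ D)
      isSolution = trans (σ-cong A≈) (σ-+ _ _) , (begin
        σ D
          ≈⟨ σ-cong D≈ ⟩
        σ (u (u (σ (σ D)) + σ B₁) + σ A)
          ≈⟨ σ-cong (solve 5 (λ X Q S B E → X :* (Q :* (X :* (Q :* S) :+ B)) :+ E
               := E :+ (X :* (Q :* B) :+ X :* (Q :* (X :* (Q :* S))))) refl x q (σ (σ D)) (σ B₁) (σ A)) ⟩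
        σ (σ A + (u (σ B₁) + u (u (σ (σ D)))))
          ≈⟨ trans (σ-+ _ _) (+-congˡ (σ-+ _ _)) ⟩
        σ (σ A) + (σ (u (σ B₁)) + σ (u (u (σ (σ D)))))
          ≈⟨ +-congˡ (+-congʳ (σ-cong (u-cong (σ-cong B₁≈b₁)))) ⟩
        W (σ A) (σ D)
          ∎)

      I≈ : I ≈ u (σ (b₂ (σ A))) + σ D
      I≈ = trans I-eq (+-congʳ (u-cong (trans B₁′-eq (σ-cong B₂≈b₂))))

    module Triangular
      (T : Carrier → Carrier)
      (T-cong : ∀ {f g} → f ≈ g → T f ≈ T g)
      (T-+ : ∀ f g → T (f + g) ≈ T f + T g)
      (T-q : ∀ f → T (q * f) ≈ q * T f)
      (T-x : ∀ f → T (x * f) ≈ x * σ (T f))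
      (T-σ : ∀ f → T (σ f) ≈ σ (T f))
      where

      uσT : ∀ f → u (σ (T f)) ≈ T (u f)
      uσT f = begin
        x * (q * σ (T f))   ≈⟨ *-congˡ (σ-q _) ⟨
        x * σ (q * T f)     ≈⟨ *-congˡ (σ-cong (T-q f)) ⟨
        x * σ (T (q * f))   ≈⟨ T-x (q * f) ⟨
        T (u f)             ∎

      σu : ∀ f → σ (u f) ≈ q * u (σ f)
      σu f = begin
        σ (u f)                 ≈⟨ σ-x (q * f) ⟩
        x * (q * σ (q * f))     ≈⟨ *-congˡ (*-congˡ (σ-q f)) ⟩
        x * (q * (q * σ f))     ≈⟨ solve 3 (λ X Q F → X :* (Q :* (Q :* F)) := Q :* (X :* (Q :* F))) refl x q (σ f) ⟩
        q * u (σ f)             ∎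

      -- The inner σ is absorbed at once by the u next to it. The outer σ first moves past the
      -- remaining u, at the cost of a factor q, and is then absorbed by that u.
      σuuσT : ∀ f → σ (u (u (σ (T f)))) ≈ T (q * u (u f))
      σuuσT f = begin
        σ (u (u (σ (T f))))   ≈⟨ σ-cong (u-cong (uσT f)) ⟩
        σ (u (T (u f)))       ≈⟨ σu _ ⟩
        q * u (σ (T (u f)))   ≈⟨ *-congˡ (uσT (u f)) ⟩
        q * T (u (u f))       ≈⟨ T-q _ ⟨
        T (q * u (u f))       ∎

      b₂T : ∀ f → b₂ (T f) ≈ T (f + u f)
      b₂T f = trans (+-congˡ (uσT f)) (sym (T-+ _ _))

      uσb₂T : ∀ f → u (σ (b₂ (T f))) ≈ T (u (f + u f))
      uσb₂T f = trans (u-cong (σ-cong (b₂T f))) (uσT _)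

      b₁T : ∀ f → b₁ (T f) ≈ T (f + u (f + u f))
      b₁T f = trans (+-congˡ (uσb₂T f)) (sym (T-+ _ _))

      module Product
        (σ-* : ∀ f g → σ (f * g) ≈ σ f * σ g)
        (α β γ δ : Carrier)
        (α-eq : α ≈ σ α + x ^ 1 * (q ^ 2 * α))
        (β-eq : β ≈ σ β + x ^ 2 * (q ^ 3 * β))
        (γ-eq : γ ≈ σ γ + x ^ 3 * (q ^ 4 * γ))
        (δ-eq : σ δ ≈ δ + x ^ 4 * (q ^ 8 * σ δ))
        where

        -- α, β, γ stand for the reciprocals of (xq²; q)_∞, (x²q³; q²)_∞, (x³q⁴; q³)_∞ and δ for
        -- (x⁴q⁸; q⁴)_∞. Dilating γ strips its first factor, so Z = (1 - x³q⁴) H.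
        H Z : Carrier
        H = α * β * γ * δ
        Z = α * β * σ γ * δ

        H-eq : H ≈ Z + q * u (u (u H))
        H-eq = begin
          α * β * γ * δ
            ≈⟨ *-congʳ (*-congˡ γ-eq) ⟩
          α * β * (σ γ + x ^ 3 * (q ^ 4 * γ)) * δ
            ≈⟨ solve 7 (λ a b c d X Q c′ →
                 a :* b :* (c′ :+ pow X 3 :* (pow Q 4 :* c)) :* d
                 := a :* b :* c′ :* d :+ Q :* (X :* (Q :* (X :* (Q :* (X :* (Q :* (a :* b :* c :* d))))))))
                 refl α β γ δ x q (σ γ) ⟩
          Z + q * u (u (u H))
            ∎

        -- What u becomes when σ is moved past it: σ u = v σ.
        v : Carrier → Carrier
        v f = x * (q * (q * f))

        unroll : α * σ δ ≈ σ α * σ δ + v (α * σ δ)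
        unroll = trans (*-congʳ α-eq)
          (solve 5 (λ a a′ d′ X Q → (a′ :+ pow X 1 :* (pow Q 2 :* a)) :* d′ := a′ :* d′ :+ X :* (Q :* (Q :* (a :* d′))))
            refl α (σ α) (σ δ) x q)

        v-cong : ∀ {f g} → f ≈ g → v f ≈ v g
        v-cong p = *-congˡ (*-congˡ (*-congˡ p))

        -- (1 - y⁴) / (1 - y) = 1 + y + y² + y³ for y = x q², with 1 - y⁴ read off from δ and 1 - y from α.
        αδ-eq : α * δ ≈ σ α * σ δ + (v (σ α * σ δ) + (v (v (σ α * σ δ)) + v (v (v (σ α * σ δ)))))
        αδ-eq = +-cancelʳ (v (v (v (v (α * σ δ))))) _ _ (begin
          α * δ + v (v (v (v (α * σ δ))))
            ≈⟨ solve 5 (λ a d d′ X Q →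
                 a :* d :+ X :* (Q :* (Q :* (X :* (Q :* (Q :* (X :* (Q :* (Q :* (X :* (Q :* (Q :* (a :* d′))))))))))))
                 := a :* (d :+ pow X 4 :* (pow Q 8 :* d′)))
                 refl α δ (σ δ) x q ⟩
          α * (δ + x ^ 4 * (q ^ 8 * σ δ))
            ≈⟨ *-congˡ δ-eq ⟨
          α * σ δ
            ≈⟨ trans unroll (+-congˡ (v-cong (trans unroll (+-congˡ (v-cong (trans unroll (+-congˡ (v-cong unroll)))))))) ⟩
          p + v (p + v (p + v (p + v (α * σ δ))))
            ≈⟨ solve 4 (λ P S X Q →
                 let V = λ F → X :* (Q :* (Q :* F)) in
                 P :+ V (P :+ V (P :+ V (P :+ V S))) := P :+ (V P :+ (V (V P) :+ V (V (V P)))) :+ V (V (V (V S))))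
                 refl p (α * σ δ) x q ⟩
          p + (v p + (v (v p) + v (v (v p)))) + v (v (v (v (α * σ δ))))
            ∎)
          where
          p : Carrier
          p = σ α * σ δ

        σH : σ H ≈ σ α * σ β * σ γ * σ δ
        σH = trans (σ-* _ _) (*-congʳ (trans (σ-* _ _) (*-congʳ (σ-* _ _))))

        σuH : σ (u (H + u (H + u H))) ≈ q * u (σ H + q * u (σ H + q * u (σ H)))
        σuH = trans (σu _) (*-congˡ (u-cong (trans (σ-+ _ _) (+-congˡ (trans (σu _)
                (*-congˡ (u-cong (trans (σ-+ _ _) (+-congˡ (σu _))))))))))

        -- The equation of β gives (1 - x²q³) Z = α δ σβ σγ. By `αδ-eq` this is 1 + y + y² + y³
        -- times σ H with y = xq², and σ produces the same polynomial out of 1 + u + u² + u³.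
        Z-eq : Z ≈ σ H + (σ (u (H + u (H + u H))) + q * u (u Z))
        Z-eq = begin
          α * β * σ γ * δ
            ≈⟨ *-congʳ (*-congʳ (*-congˡ β-eq)) ⟩
          α * (σ β + x ^ 2 * (q ^ 3 * β)) * σ γ * δ
            ≈⟨ solve 7 (λ a b b′ c′ d X Q →
                 a :* (b′ :+ pow X 2 :* (pow Q 3 :* b)) :* c′ :* d
                 := (a :* d) :* (b′ :* c′) :+ Q :* (X :* (Q :* (X :* (Q :* (a :* b :* c′ :* d))))))
                 refl α β (σ β) (σ γ) δ x q ⟩
          α * δ * (σ β * σ γ) + q * u (u Z)
            ≈⟨ +-congʳ (trans (*-congʳ αδ-eq) (solve 6 (λ a′ b′ c′ d′ X Q →
                 let V = λ F → X :* (Q :* (Q :* F)) ; U = λ F → Q :* (X :* (Q :* F))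
                     P = a′ :* d′ ; S = a′ :* b′ :* c′ :* d′ in
                 (P :+ (V P :+ (V (V P) :+ V (V (V P))))) :* (b′ :* c′)
                 := S :+ U (S :+ U (S :+ U S)))
                 refl (σ α) (σ β) (σ γ) (σ δ) x q)) ⟩
          s + q * u (s + q * u (s + q * u s)) + q * u (u Z)
            ≈⟨ +-congʳ (+-cong σH (*-congˡ (u-cong (+-cong σH (*-congˡ (u-cong (+-cong σH (*-congˡ (u-cong σH))))))))) ⟨
          σ H + q * u (σ H + q * u (σ H + q * u (σ H))) + q * u (u Z)
            ≈⟨ +-assoc _ _ _ ⟩
          σ H + (q * u (σ H + q * u (σ H + q * u (σ H))) + q * u (u Z))
            ≈⟨ +-congˡ (+-congʳ σuH) ⟨
          σ H + (σ (u (H + u (H + u H))) + q * u (u Z))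
            ∎
          where
          s : Carrier
          s = σ α * σ β * σ γ * σ δ

        -- By `H-eq`, Z is H less x³q⁴ H. The lost amount is added on both sides and cancelled at
        -- the end.
        Z+≈N : u (H + u H) + Z ≈ N H
        Z+≈N = +-cancelʳ (q * u (u (u H))) _ _ (begin
          u (H + u H) + Z + q * u (u (u H))
            ≈⟨ +-assoc _ _ _ ⟩
          u (H + u H) + (Z + q * u (u (u H)))
            ≈⟨ +-congˡ H-eq ⟨
          u (H + u H) + H
            ≈⟨ solve 3 (λ F X Q → let U = λ F → X :* (Q :* F) in
                 U (F :+ U F) :+ F := F :+ (U F :+ U (U F))) refl H x q ⟩
          H + (u H + u (u H))
            ≈⟨ +-identityʳ _ ⟨
          H + (u H + u (u H)) + 0#
            ≈⟨ +-congˡ (trans (+-congʳ (-1*x≈-x _)) (-‿inverseˡ _)) ⟨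
          H + (u H + u (u H)) + (- 1# * (q * u (u (u H))) + q * u (u (u H)))
            ≈⟨ +-assoc _ _ _ ⟨
          N H + q * u (u (u H))
            ∎)

        uσb₂+T≈TN : u (σ (b₂ (T H))) + T Z ≈ T (N H)
        uσb₂+T≈TN = trans (+-congʳ (uσb₂T H)) (trans (sym (T-+ _ _)) (T-cong Z+≈N))

        isSolution : IsSolution (T H) (T Z)
        isSolution = (begin
          T H                         ≈⟨ T-cong H-eq ⟩
          T (Z + q * u (u (u H)))     ≈⟨ T-+ _ _ ⟩
          T Z + T (q * u (u (u H)))   ≈⟨ +-congˡ (σuuσT (u H)) ⟨
          T Z + σ (u (u (σ (T (u H)))))  ≈⟨ +-congˡ (σ-cong (u-cong (u-cong (σ-cong (uσT H))))) ⟨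
          T Z + Y (T H)               ∎) , (begin
          T Z
            ≈⟨ T-cong Z-eq ⟩
          T (σ H + (σ (u (H + u (H + u H))) + q * u (u Z)))
            ≈⟨ trans (T-+ _ _) (+-congˡ (T-+ _ _)) ⟩
          T (σ H) + (T (σ (u (H + u (H + u H)))) + T (q * u (u Z)))
            ≈⟨ +-cong (T-σ H) (+-cong (trans (T-σ _) (σ-cong (sym (trans (u-cong (σ-cong (b₁T H))) (uσT _))))) (sym (σuuσT Z))) ⟩
          W (T H) (T Z)
            ∎)

-- Finite sums over lists

module ListSum {c ℓ} (R : CommutativeRing c ℓ) where

  open CommutativeRing R
  open SetoidReasoning setoid

  ∑ᴸ : {I : Set} → (I → Carrier) → List I → Carrier
  ∑ᴸ f is = foldr _+_ 0# (map f is)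

  module _ {I : Set} where

    ∑ᴸ-cong : ∀ {f g : I → Carrier} → (∀ i → f i ≈ g i) → ∀ is → ∑ᴸ f is ≈ ∑ᴸ g is
    ∑ᴸ-cong p []       = refl
    ∑ᴸ-cong p (i ∷ is) = +-cong (p i) (∑ᴸ-cong p is)

    ∑ᴸ-++ : ∀ (f : I → Carrier) is js → ∑ᴸ f (is ++ js) ≈ ∑ᴸ f is + ∑ᴸ f js
    ∑ᴸ-++ f []       js = sym (+-identityˡ _)
    ∑ᴸ-++ f (i ∷ is) js = trans (+-congˡ (∑ᴸ-++ f is js)) (sym (+-assoc _ _ _))

    ∑ᴸ-map : ∀ {J : Set} (f : I → Carrier) (h : J → I) js → ∑ᴸ f (map h js) ≡ ∑ᴸ (f ∘ h) js
    ∑ᴸ-map f h js = ≡.cong (foldr _+_ 0#) (≡.sym (map-∘ js))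

    -- Asked of a bare additive map, so that it serves both multiplication by an element and the
    -- operator `TN`.
    ∑ᴸ-homo : ∀ (h : Carrier → Carrier) → h 0# ≈ 0# → (∀ x y → h (x + y) ≈ h x + h y) →
              ∀ (f : I → Carrier) is → h (∑ᴸ f is) ≈ ∑ᴸ (h ∘ f) is
    ∑ᴸ-homo h h0 h+ f []       = h0
    ∑ᴸ-homo h h0 h+ f (i ∷ is) = trans (h+ _ _) (+-congˡ (∑ᴸ-homo h h0 h+ f is))

    *-distribˡ-∑ᴸ : ∀ x (f : I → Carrier) is → x * ∑ᴸ f is ≈ ∑ᴸ (λ i → x * f i) is
    *-distribˡ-∑ᴸ x = ∑ᴸ-homo (x *_) (zeroʳ x) (distribˡ x)

  ∑ᴸ-* : ∀ {I J : Set} (f : I → Carrier) (g : J → Carrier) is js →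
         ∑ᴸ f is * ∑ᴸ g js ≈ ∑ᴸ (λ (i , j) → f i * g j) (cartesianProduct is js)
  ∑ᴸ-* f g []       js = zeroˡ _
  ∑ᴸ-* f g (i ∷ is) js = begin
    (f i + ∑ᴸ f is) * ∑ᴸ g js
      ≈⟨ distribʳ _ _ _ ⟩
    f i * ∑ᴸ g js + ∑ᴸ f is * ∑ᴸ g js
      ≈⟨ +-cong (*-distribˡ-∑ᴸ (f i) g js) (∑ᴸ-* f g is js) ⟩
    ∑ᴸ (λ j → f i * g j) js + ∑ᴸ h (cartesianProduct is js)
      ≡⟨ ≡.cong (_+ ∑ᴸ h (cartesianProduct is js)) (∑ᴸ-map h (i ,_) js) ⟨
    ∑ᴸ h (map (i ,_) js) + ∑ᴸ h (cartesianProduct is js)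
      ≈⟨ ∑ᴸ-++ h (map (i ,_) js) (cartesianProduct is js) ⟨
    ∑ᴸ h (cartesianProduct (i ∷ is) js)
      ∎
    where
    h : _ × _ → Carrier
    h (i , j) = f i * g j

-- Formal power series over a commutative ring, to be nested for q and x

module PowerSeries {c ℓ} (R : CommutativeRing c ℓ) where

  open CommutativeRing R
  open RawMonoidDefinitions +-rawMonoid using (sum)
  open CommutativeSemigroupProperties +-commutativeSemigroup using (interchange)
  open CommutativeSemigroupProperties *-commutativeSemigroup using (x∙yz≈y∙xz)
  module ≈-Reasoning = SetoidReasoning setoid

  Series : Set c
  Series = ℕ → Carrier

  infix 4 _≋_ _≋[_]_
  infixl 6 _⊕_
  infixl 7 _⊛_ _·_

  _≋_ : Series → Series → Set ℓ
  f ≋ g = ∀ n → f n ≈ g n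

  -- Congruence modulo X^n. With `≋[]⇒≋` it replaces every appeal to X-adic limits.
  _≋[_]_ : Series → ℕ → Series → Set ℓ
  f ≋[ n ] g = ∀ m → m < n → f m ≈ g m

  _⊕_ : Series → Series → Series
  (f ⊕ g) n = f n + g n

  opaque
    -- The same convolution formula as `_*q_`, so the two agree once unfolded.
    _⊛_ : Series → Series → Series
    (f ⊛ g) n = sum {suc n} λ k → f (toℕ k) * g (n ∸ toℕ k)

  _·_ : Carrier → Series → Series
  (r · f) n = r * f n

  const : Carrier → Series
  const r zero    = r
  const r (suc n) = 0#

  X : Series
  X zero    = 0#
  X (suc n) = const 1# n

  tail : Series → Series
  tail f = f ∘ suc

  opaque
    unfolding _⊛_

    ⊛-cong : ∀ {f f′ g g′} → f ≋ f′ → g ≋ g′ → f ⊛ g ≋ f′ ⊛ g′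
    ⊛-cong p q zero    = +-congʳ (*-cong (p 0) (q 0))
    ⊛-cong p q (suc n) = +-cong (*-cong (p 0) (q (suc n))) (⊛-cong (p ∘ suc) q n)

    ⊛-coefficient-zero : ∀ f g → (f ⊛ g) 0 ≈ f 0 * g 0
    ⊛-coefficient-zero f g = +-identityʳ _

    ⊛-zeroˡ : ∀ f → (λ _ → 0#) ⊛ f ≋ (λ _ → 0#)
    ⊛-zeroˡ f zero    = trans (+-identityʳ _) (zeroˡ _)
    ⊛-zeroˡ f (suc n) = trans (+-cong (zeroˡ _) (⊛-zeroˡ f n)) (+-identityʳ 0#)

    const-⊛ : ∀ r f → const r ⊛ f ≋ r · f
    const-⊛ r f zero    = +-identityʳ _
    const-⊛ r f (suc n) = trans (+-congˡ (⊛-zeroˡ f n)) (+-identityʳ _)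

    ⊛-identityˡ : ∀ f → const 1# ⊛ f ≋ f
    ⊛-identityˡ f n = trans (const-⊛ 1# f n) (*-identityˡ _)

    ·-⊛ : ∀ r f g → (r · f) ⊛ g ≋ r · (f ⊛ g)
    ·-⊛ r f g zero    = trans (+-congʳ (*-assoc r _ _)) (trans (+-congˡ (sym (zeroʳ r))) (sym (distribˡ r _ _)))
    ·-⊛ r f g (suc n) = trans (+-cong (*-assoc r _ _) (·-⊛ r (tail f) g n)) (sym (distribˡ r _ _))

    ⊛-distribʳ : ∀ h f g → (f ⊕ g) ⊛ h ≋ (f ⊛ h) ⊕ (g ⊛ h)
    ⊛-distribʳ h f g zero    =
      trans (+-cong (distribʳ (h 0) (f 0) (g 0)) (sym (+-identityʳ 0#))) (interchange _ _ _ _)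
    ⊛-distribʳ h f g (suc n) =
      trans (+-cong (distribʳ (h (suc n)) (f 0) (g 0)) (⊛-distribʳ h (tail f) (tail g) n))
            (interchange _ _ _ _)

    ⊛-assoc : ∀ f g h → (f ⊛ g) ⊛ h ≋ f ⊛ (g ⊛ h)
    ⊛-assoc f g h zero    = +-congʳ (begin
      (f 0 * g 0 + 0#) * h 0    ≈⟨ *-congʳ (+-identityʳ _) ⟩
      f 0 * g 0 * h 0           ≈⟨ *-assoc _ _ _ ⟩
      f 0 * (g 0 * h 0)         ≈⟨ *-congˡ (+-identityʳ _) ⟨
      f 0 * (g 0 * h 0 + 0#)    ∎)
      where open ≈-Reasoning
    ⊛-assoc f g h (suc n) = begin
      (f 0 * g 0 + 0#) * h (suc n) + ((f 0 · tail g ⊕ tail f ⊛ g) ⊛ h) n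
        ≈⟨ +-cong (*-congʳ (+-identityʳ _)) (⊛-distribʳ h (f 0 · tail g) (tail f ⊛ g) n) ⟩
      f 0 * g 0 * h (suc n) + (((f 0 · tail g) ⊛ h) n + ((tail f ⊛ g) ⊛ h) n)
        ≈⟨ +-cong (*-assoc _ _ _) (+-cong (·-⊛ (f 0) (tail g) h n) (⊛-assoc (tail f) g h n)) ⟩
      f 0 * (g 0 * h (suc n)) + (f 0 * (tail g ⊛ h) n + (tail f ⊛ (g ⊛ h)) n)
        ≈⟨ +-assoc _ _ _ ⟨
      f 0 * (g 0 * h (suc n)) + f 0 * (tail g ⊛ h) n + (tail f ⊛ (g ⊛ h)) n
        ≈⟨ +-congʳ (distribˡ (f 0) _ _) ⟨
      f 0 * (g ⊛ h) (suc n) + (tail f ⊛ (g ⊛ h)) n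
        ∎
      where open ≈-Reasoning

    -- The convolution computes by splitting off its first summand; commutativity also needs the
    -- last one split off.
    ⊛-suc : ∀ f g n → (f ⊛ g) (suc n) ≈ (f ⊛ tail g) n + f (suc n) * g 0
    ⊛-suc f g zero    = trans (sym (+-assoc _ _ _)) (trans (+-identityʳ _) (+-congʳ (sym (+-identityʳ _))))
    ⊛-suc f g (suc n) = trans (+-congˡ (⊛-suc (tail f) g n)) (sym (+-assoc _ _ _))

    ⊛-comm : ∀ f g → f ⊛ g ≋ g ⊛ f
    ⊛-comm f g zero    = +-congʳ (*-comm _ _)
    ⊛-comm f g (suc n) = begin
      f 0 * g (suc n) + (tail f ⊛ g) n   ≈⟨ +-cong (*-comm _ _) (⊛-comm (tail f) g n) ⟩
      g (suc n) * f 0 + (g ⊛ tail f) n   ≈⟨ +-comm _ _ ⟩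
      (g ⊛ tail f) n + g (suc n) * f 0   ≈⟨ ⊛-suc g f n ⟨
      (g ⊛ f) (suc n)                    ∎
      where open ≈-Reasoning

  commutativeRing : CommutativeRing c ℓ
  commutativeRing = record
    { Carrier = Series
    ; _≈_ = _≋_
    ; _+_ = _⊕_
    ; _*_ = _⊛_
    ; -_  = λ f n → - f n
    ; 0#  = λ _ → 0#
    ; 1#  = const 1#
    ; isCommutativeRing = record
      { isRing = record
        { +-isAbelianGroup = Pointwise.isAbelianGroup ℕ +-isAbelianGroup
        ; *-cong     = ⊛-cong
        ; *-assoc    = ⊛-assoc
        ; *-identity = comm∧idˡ⇒id ⊛-comm ⊛-identityˡ
        ; distrib    = comm∧distrʳ⇒distr ⊕-cong ⊛-comm ⊛-distribʳ
        }
      ; *-comm = ⊛-comm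
      }
    }
    where
    ⊕-cong : ∀ {f f′ g g′} → f ≋ f′ → g ≋ g′ → f ⊕ g ≋ f′ ⊕ g′
    ⊕-cong p q n = +-cong (p n) (q n)
    open AbelianGroup (Pointwise.abelianGroup ℕ +-abelianGroup) using () renaming (setoid to seriesSetoid)
    open Consequences seriesSetoid using (comm∧idˡ⇒id; comm∧distrʳ⇒distr)

  module S = CommutativeRing commutativeRing
  module ≋-Reasoning = SetoidReasoning S.setoid
  open Exp commutativeSemiring using (_^_; ^-homo-*; ^-assocʳ)
  open Exp S.commutativeSemiring using () renaming (_^_ to _^ˢ_; ^-homo-* to ^ˢ-homo-*)
  open CommutativeSemigroupProperties S.*-commutativeSemigroup using () renaming (x∙yz≈y∙xz to x∙yz≈y∙xzˢ; interchange to interchangeˢ)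
  open RingProperties ring using (-0#≈0#)

  opaque
    unfolding _⊛_

    X⊛-suc : ∀ f n → (X ⊛ f) (suc n) ≈ f n
    X⊛-suc f n = trans (+-congʳ (zeroˡ _)) (trans (+-identityˡ _) (⊛-identityˡ f n))

    X⊛-zero : ∀ f → (X ⊛ f) 0 ≈ 0#
    X⊛-zero f = trans (+-identityʳ _) (zeroˡ _)

  ≋⇒≋[] : ∀ {f g n} → f ≋ g → f ≋[ n ] g
  ≋⇒≋[] p m _ = p m

  ≋[]-trans : ∀ {f g h n} → f ≋[ n ] g → g ≋[ n ] h → f ≋[ n ] h
  ≋[]-trans p q m m<n = trans (p m m<n) (q m m<n)

  ⊕-cong[] : ∀ {f f′ g g′ n} → f ≋[ n ] f′ → g ≋[ n ] g′ → f ⊕ g ≋[ n ] f′ ⊕ g′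
  ⊕-cong[] p q m m<n = +-cong (p m m<n) (q m m<n)

  opaque
    unfolding _⊛_

    ⊛-cong[] : ∀ {f f′ g g′ n} → f ≋[ n ] f′ → g ≋[ n ] g′ → f ⊛ g ≋[ n ] f′ ⊛ g′
    ⊛-cong[] p q zero    0<n = +-congʳ (*-cong (p 0 0<n) (q 0 0<n))
    ⊛-cong[] {n = suc n} p q (suc m) m<n =
      +-cong (*-cong (p 0 z<s) (q (suc m) m<n))
             (⊛-cong[] (λ k k<n → p (suc k) (s<s k<n)) (λ k k<n → q k (ℕ.m<n⇒m<1+n k<n)) m (s<s⁻¹ m<n))

  -- A factor X raises the precision by one. This is the contraction behind the uniqueness proofs.
  X⊛-cong[] : ∀ {f g n} → f ≋[ n ] g → X ⊛ f ≋[ suc n ] X ⊛ g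
  X⊛-cong[] {f} {g} p zero    _   = trans (X⊛-zero f) (sym (X⊛-zero g))
  X⊛-cong[] {f} {g} p (suc m) m<n = trans (X⊛-suc f m) (trans (p m (s<s⁻¹ m<n)) (sym (X⊛-suc g m)))

  ≋[]⇒≋ : ∀ {f g} → (∀ n → f ≋[ n ] g) → f ≋ g
  ≋[]⇒≋ p n = p (suc n) n ℕ.≤-refl

  module _ (f : Series) where

    X^⊛-< : ∀ {k n} → n < k → (X ^ˢ k ⊛ f) n ≈ 0#
    X^⊛-< {suc k} {zero}  _   = trans (⊛-assoc X (X ^ˢ k) f 0) (X⊛-zero (X ^ˢ k ⊛ f))
    X^⊛-< {suc k} {suc n} n<k =
      trans (⊛-assoc X (X ^ˢ k) f (suc n)) (trans (X⊛-suc (X ^ˢ k ⊛ f) n) (X^⊛-< {k} {n} (s<s⁻¹ n<k)))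

    X^⊛-+ : ∀ k n → (X ^ˢ k ⊛ f) (k ℕ.+ n) ≈ f n
    X^⊛-+ zero    n = ⊛-identityˡ f n
    X^⊛-+ (suc k) n = trans (⊛-assoc X (X ^ˢ k) f (suc k ℕ.+ n)) (trans (X⊛-suc (X ^ˢ k ⊛ f) (k ℕ.+ n)) (X^⊛-+ k n))

  -- The map f ↦ X w f + c is an X-adic contraction, and each use of the equation settles one more
  -- coefficient.
  X⊛-affine-unique : ∀ {f g} w c → f ≋ X ⊛ (w ⊛ f) ⊕ c → g ≋ X ⊛ (w ⊛ g) ⊕ c → f ≋ g
  X⊛-affine-unique {f} {g} w c f-eq g-eq = ≋[]⇒≋ agree
    where
    agree : ∀ n → f ≋[ n ] g
    agree zero    m ()
    agree (suc n) m m<n = trans (f-eq m) (trans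
      (+-congʳ (X⊛-cong[] (⊛-cong[] {w} {w} (λ _ _ → refl) (agree n)) m m<n))
      (sym (g-eq m)))

  infixr 8 _⊙_
  -- The Hadamard product. Dilation and the triangular operator are both of this kind, so their
  -- linearity is proved once, for arbitrary weights w.
  _⊙_ : Series → Series → Series
  (w ⊙ f) n = w n * f n

  ⊙-cong : ∀ w {f g} → f ≋ g → w ⊙ f ≋ w ⊙ g
  ⊙-cong w p n = *-congˡ (p n)

  ⊙-cong[] : ∀ w {f g n} → f ≋[ n ] g → w ⊙ f ≋[ n ] w ⊙ g
  ⊙-cong[] w p m m<n = *-congˡ (p m m<n)

  ⊙-⊕ : ∀ w f g → w ⊙ (f ⊕ g) ≋ w ⊙ f ⊕ w ⊙ g
  ⊙-⊕ w f g n = distribˡ (w n) (f n) (g n)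

  ⊙-const : ∀ w r f → w ⊙ (const r ⊛ f) ≋ const r ⊛ w ⊙ f
  ⊙-const w r f n = begin
    w n * (const r ⊛ f) n   ≈⟨ *-congˡ (const-⊛ r f n) ⟩
    w n * (r * f n)         ≈⟨ x∙yz≈y∙xz (w n) r (f n) ⟩
    r * (w n * f n)         ≈⟨ const-⊛ r (w ⊙ f) n ⟨
    (const r ⊛ w ⊙ f) n     ∎
    where open ≈-Reasoning

  ⊙-X : ∀ w f → w ⊙ (X ⊛ f) ≋ X ⊛ (tail w ⊙ f)
  ⊙-X w f zero    = trans (*-congˡ (X⊛-zero f)) (trans (zeroʳ (w 0)) (sym (X⊛-zero (tail w ⊙ f))))
  ⊙-X w f (suc n) = trans (*-congˡ (X⊛-suc f n)) (sym (X⊛-suc (tail w ⊙ f) n))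

  -- The number n(n-1)/2, by its recurrence rather than by a division.
  triangle : ℕ → ℕ
  triangle zero    = 0
  triangle (suc n) = n ℕ.+ triangle n

  const-cong : ∀ {a b} → a ≈ b → const a ≋ const b
  const-cong p zero    = p
  const-cong p (suc n) = refl

  const-+ : ∀ a b → const (a + b) ≋ const a ⊕ const b
  const-+ a b zero    = refl
  const-+ a b (suc n) = sym (+-identityʳ 0#)

  const-* : ∀ a b → const (a * b) ≋ const a ⊛ const b
  const-* a b zero    = sym (const-⊛ a (const b) 0)
  const-* a b (suc n) = trans (sym (zeroʳ a)) (sym (const-⊛ a (const b) (suc n)))

  const-^ : ∀ a k → const (a ^ k) ≋ const a ^ˢ k
  const-^ a zero    = S.refl
  const-^ a (suc k) = S.trans (const-* a (a ^ k)) (S.*-congˡ {const a} (const-^ a k))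

  ⊙-const₀ : ∀ w a → w ⊙ const a ≋ const (w 0 * a)
  ⊙-const₀ w a zero    = refl
  ⊙-const₀ w a (suc n) = zeroʳ _

  ⊙-X^ : ∀ w k f → w ⊙ (X ^ˢ k ⊛ f) ≋ X ^ˢ k ⊛ (λ n → w (k ℕ.+ n)) ⊙ f
  ⊙-X^ w zero    f = S.trans (⊙-cong w (⊛-identityˡ f)) (S.sym (⊛-identityˡ (w ⊙ f)))
  ⊙-X^ w (suc k) f = S.trans (⊙-cong w (⊛-assoc X (X ^ˢ k) f)) (S.trans (⊙-X w (X ^ˢ k ⊛ f))
    (S.trans (S.*-congˡ {X} (⊙-X^ (tail w) k f)) (S.sym (⊛-assoc X (X ^ˢ k) _))))

  X^⊛-cong[] : ∀ {f g n} k → f ≋[ n ] g → X ^ˢ suc k ⊛ f ≋[ suc n ] X ^ˢ suc k ⊛ g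
  X^⊛-cong[] {f} {g} k p = ≋[]-trans (≋⇒≋[] (⊛-assoc X (X ^ˢ k) f))
    (≋[]-trans (X⊛-cong[] (⊛-cong[] {X ^ˢ k} {X ^ˢ k} (λ _ _ → refl) p))
               (≋⇒≋[] (S.sym (⊛-assoc X (X ^ˢ k) g))))

  X^-coefficient : ∀ k n → (X ^ˢ k) n ≈ (if ⌊ n ≟ k ⌋ then 1# else 0#)
  X^-coefficient k n = trans (sym (S.*-identityʳ (X ^ˢ k) n)) (X^⊛1 k n)
    where
    X^⊛1 : ∀ k n → (X ^ˢ k ⊛ const 1#) n ≈ (if ⌊ n ≟ k ⌋ then 1# else 0#)
    X^⊛1 k n with n ≟ k
    X^⊛1 k k | yes ≡.refl = ≡.subst (λ i → (X ^ˢ k ⊛ const 1#) i ≈ 1#) (ℕ.+-identityʳ k) (X^⊛-+ (const 1#) k 0)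
    X^⊛1 k n | no n≢k with ℕ.≤-total n k
    ... | inj₁ n≤k = X^⊛-< (const 1#) (ℕ.≤∧≢⇒< n≤k n≢k)
    ... | inj₂ k≤n with ℕ.m≤n⇒∃[o]m+o≡n k≤n
    ...   | zero  , eq = contradiction (≡.trans (≡.sym eq) (ℕ.+-identityʳ k)) n≢k
    ...   | suc o , ≡.refl = X^⊛-+ (const 1#) k (suc o)

  mono : Carrier → ℕ → Series
  mono a k = const a ⊛ X ^ˢ k

  mono-cong : ∀ {a b} k → a ≈ b → mono a k ≋ mono b k
  mono-cong k p = S.*-congʳ (const-cong p)

  mono-⊛ : ∀ a j b k → mono a j ⊛ mono b k ≋ mono (a * b) (j ℕ.+ k)
  mono-⊛ a j b k = S.trans (interchangeˢ (const a) (X ^ˢ j) (const b) (X ^ˢ k))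
    (S.sym (S.*-cong (const-* a b) (^ˢ-homo-* X j k)))

  const-mono : ∀ r a k → const r ⊛ mono a k ≋ mono (r * a) k
  const-mono r a k = S.trans (S.sym (⊛-assoc (const r) (const a) (X ^ˢ k))) (S.*-congʳ (S.sym (const-* r a)))

  X-mono : ∀ a k → X ⊛ mono a k ≋ mono a (suc k)
  X-mono a k = x∙yz≈y∙xzˢ X (const a) (X ^ˢ k)

  mono-coefficient : ∀ a k n → mono a k n ≈ a * (X ^ˢ k) n
  mono-coefficient a k = const-⊛ a (X ^ˢ k)

  mono-≋[] : ∀ a k → mono a k ≋[ k ] (λ _ → 0#)
  mono-≋[] a k n n<k = trans (S.*-comm (const a) (X ^ˢ k) n) (X^⊛-< (const a) n<k)

  ⊙-mono : ∀ w a k → w ⊙ mono a k ≋ mono (w k * a) k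
  ⊙-mono w a k = begin
    w ⊙ (const a ⊛ X ^ˢ k)
      ≈⟨ ⊙-cong w (S.*-comm (const a) (X ^ˢ k)) ⟩
    w ⊙ (X ^ˢ k ⊛ const a)
      ≈⟨ ⊙-X^ w k (const a) ⟩
    X ^ˢ k ⊛ (λ n → w (k ℕ.+ n)) ⊙ const a
      ≈⟨ S.*-congˡ {X ^ˢ k} (⊙-const₀ (λ n → w (k ℕ.+ n)) a) ⟩
    X ^ˢ k ⊛ const (w (k ℕ.+ 0) * a)
      ≈⟨ S.*-comm (X ^ˢ k) _ ⟩
    mono (w (k ℕ.+ 0) * a) k
      ≡⟨ ≡.cong (λ i → mono (w i * a) k) (ℕ.+-identityʳ k) ⟩
    mono (w k * a) k
      ∎
    where open ≋-Reasoning

  module _ {I : Set} where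
    open ListSum R using () renaming (∑ᴸ to ∑ᴿ)
    open ListSum commutativeRing using (∑ᴸ)

    ∑ᴸ-coefficient : ∀ (f : I → Series) n is → ∑ᴸ f is n ≡ ∑ᴿ (λ i → f i n) is
    ∑ᴸ-coefficient f n []       = ≡.refl
    ∑ᴸ-coefficient f n (i ∷ is) = ≡.cong (f i n +_) (∑ᴸ-coefficient f n is)

  -- Substituting a power of the variable

  module Stretch (t-1 : ℕ) where

    t : ℕ
    t = suc t-1

    -- The first N terms in Horner form. As t ≥ 1, they already fix all coefficients below N.
    truncated : Series → ℕ → Series
    truncated d zero    = λ _ → 0#
    truncated d (suc N) = const (d 0) ⊕ X ^ˢ t ⊛ truncated (tail d) N

    -- d(X ^ t)
    stretch : Series → Series
    stretch d n = truncated d (suc n) n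

    truncated-stable : ∀ d {N N′} → N ≤ N′ → truncated d N ≋[ N ] truncated d N′
    truncated-stable d z≤n       = λ _ ()
    truncated-stable d (s≤s N≤N′) =
      ⊕-cong[] {const (d 0)} (λ _ _ → refl) (X^⊛-cong[] t-1 (truncated-stable (tail d) N≤N′))

    stretch≋[] : ∀ d N → stretch d ≋[ N ] truncated d N
    stretch≋[] d N m m<N = truncated-stable d m<N m ℕ.≤-refl

    stretch-step : ∀ d → stretch d ≋ const (d 0) ⊕ X ^ˢ t ⊛ stretch (tail d)
    -- The truncated tail is right only below degree n; the factor X^t, with t ≥ 1, gains the
    -- missing degree.
    stretch-step d n = +-congˡ (sym (X^⊛-cong[] t-1 (stretch≋[] (tail d) n) n ℕ.≤-refl))

    stretch-zero : ∀ d → stretch d 0 ≈ d 0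
    stretch-zero d = trans (+-congˡ (X^⊛-< (λ _ → 0#) {t} {0} z<s)) (+-identityʳ _)

    truncated-cong : ∀ {d e} → d ≋ e → ∀ N → truncated d N ≋ truncated e N
    truncated-cong p zero    = S.refl
    truncated-cong p (suc N) = S.+-cong (const-cong (p 0)) (S.*-congˡ {X ^ˢ t} (truncated-cong (p ∘ suc) N))

    stretch-cong : ∀ {d e} → d ≋ e → stretch d ≋ stretch e
    stretch-cong p n = truncated-cong p (suc n) n

    truncated-⊕ : ∀ d e N → truncated (d ⊕ e) N ≋ truncated d N ⊕ truncated e N
    truncated-⊕ d e zero    n = sym (+-identityʳ 0#)
    truncated-⊕ d e (suc N) = S.trans
      (S.+-cong (const-+ (d 0) (e 0)) (S.trans (S.*-congˡ {X ^ˢ t} (truncated-⊕ (tail d) (tail e) N)) (S.distribˡ (X ^ˢ t) _ _)))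
      (λ n → interchange _ _ _ _)

    stretch-⊕ : ∀ d e → stretch (d ⊕ e) ≋ stretch d ⊕ stretch e
    stretch-⊕ d e n = truncated-⊕ d e (suc n) n

    ⊙-truncated : ∀ w d N → w ⊙ truncated d N ≋ truncated ((λ i → w (i ℕ.* t)) ⊙ d) N
    ⊙-truncated w d zero    n = zeroʳ _
    ⊙-truncated w d (suc N) = S.trans (⊙-⊕ w (const (d 0)) (X ^ˢ t ⊛ truncated (tail d) N))
      (S.+-cong (⊙-const₀ w (d 0)) (S.trans (⊙-X^ w t (truncated (tail d) N))
        (S.*-congˡ {X ^ˢ t} (⊙-truncated (λ n → w (t ℕ.+ n)) (tail d) N))))

    ⊙-stretch : ∀ w d → w ⊙ stretch d ≋ stretch ((λ i → w (i ℕ.* t)) ⊙ d)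
    ⊙-stretch w d n = ⊙-truncated w d (suc n) n

    -- Turns a recurrence between coefficients into a functional equation: a shift of the index is
    -- multiplication by X^t.
    stretch-recurrence : ∀ {d d′ : Series} c e → d 0 ≈ d′ 0 → (∀ i → d (suc i) ≈ d′ (suc i) + c * e i) →
      stretch d ≋ stretch d′ ⊕ X ^ˢ t ⊛ (const c ⊛ stretch e)
    stretch-recurrence {d} {d′} c e d₀≈ d-rec = begin
      stretch d
        ≈⟨ stretch-step d ⟩
      const (d 0) ⊕ X ^ˢ t ⊛ stretch (tail d)
        ≈⟨ S.+-cong (const-cong d₀≈) (S.*-congˡ {X ^ˢ t} (S.trans (stretch-cong d-rec) (stretch-⊕ (tail d′) (c · e)))) ⟩
      const (d′ 0) ⊕ X ^ˢ t ⊛ (stretch (tail d′) ⊕ stretch (c · e))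
        ≈⟨ S.+-congˡ {const (d′ 0)} (S.distribˡ (X ^ˢ t) _ _) ⟩
      const (d′ 0) ⊕ (X ^ˢ t ⊛ stretch (tail d′) ⊕ X ^ˢ t ⊛ stretch (c · e))
        ≈⟨ S.+-assoc (const (d′ 0)) _ _ ⟨
      const (d′ 0) ⊕ X ^ˢ t ⊛ stretch (tail d′) ⊕ X ^ˢ t ⊛ stretch (c · e)
        ≈⟨ S.+-cong (stretch-step d′) (S.*-congˡ {X ^ˢ t} (S.trans (const-⊛ c (stretch e)) (⊙-stretch (λ _ → c) e))) ⟨
      stretch d′ ⊕ X ^ˢ t ⊛ (const c ⊛ stretch e)
        ∎
      where open ≋-Reasoning

    open ListSum commutativeRing

    truncated-∑ᴸ : ∀ d N → truncated d N ≋ ∑ᴸ (λ i → const (d i) ⊛ X ^ˢ (i ℕ.* t)) (upTo N)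
    truncated-∑ᴸ d N = S.trans (go d N) (S.reflexive (≡.cong (foldr _⊕_ (λ _ → 0#)) (≡.sym (map-upTo _ N))))
      where
      go : ∀ d N → truncated d N ≋ foldr _⊕_ (λ _ → 0#) (applyUpTo (λ i → const (d i) ⊛ X ^ˢ (i ℕ.* t)) N)
      go d zero    = S.refl
      go d (suc N) = S.+-cong (S.sym (S.*-identityʳ (const (d 0)))) (begin
        X ^ˢ t ⊛ truncated (tail d) N
          ≈⟨ S.*-congˡ {X ^ˢ t} (truncated-∑ᴸ (tail d) N) ⟩
        X ^ˢ t ⊛ ∑ᴸ (λ i → const (d (suc i)) ⊛ X ^ˢ (i ℕ.* t)) (upTo N)
          ≈⟨ *-distribˡ-∑ᴸ (X ^ˢ t) _ (upTo N) ⟩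
        ∑ᴸ (λ i → X ^ˢ t ⊛ (const (d (suc i)) ⊛ X ^ˢ (i ℕ.* t))) (upTo N)
          ≈⟨ ∑ᴸ-cong (λ i → S.trans (x∙yz≈y∙xzˢ (X ^ˢ t) (const (d (suc i))) (X ^ˢ (i ℕ.* t)))
               (S.*-congˡ {const (d (suc i))} (S.sym (^ˢ-homo-* X t (i ℕ.* t))))) (upTo N) ⟩
        ∑ᴸ (λ i → const (d (suc i)) ⊛ X ^ˢ (suc i ℕ.* t)) (upTo N)
          ≡⟨ ≡.cong (foldr _⊕_ (λ _ → 0#)) (map-upTo _ N) ⟩
        foldr _⊕_ (λ _ → 0#) (applyUpTo (λ i → const (d (suc i)) ⊛ X ^ˢ (suc i ℕ.* t)) N)
          ∎)
        where open ≋-Reasoning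

  -- Dilation, the triangular operator, and uniqueness for the system

  module Dilation (r : Carrier) where

    -- f(X) ↦ f(r X)
    σ : Series → Series
    σ f = (r ^_) ⊙ f

    T : Series → Series
    T f = (λ n → r ^ triangle n) ⊙ f

    σ-X : ∀ f → σ (X ⊛ f) ≋ X ⊛ (const r ⊛ σ f)
    σ-X f = S.trans (⊙-X (r ^_) f) (S.*-congˡ {X} λ n → trans (*-assoc r _ _) (sym (const-⊛ r (σ f) n)))

    -- The exponent n(n-1)/2 grows by n from n to n + 1, and the factor r^n is a dilation.
    T-X : ∀ f → T (X ⊛ f) ≋ X ⊛ σ (T f)
    T-X f = S.trans (⊙-X (λ n → r ^ triangle n) f)
      (S.*-congˡ {X} λ n → trans (*-congʳ (^-homo-* r n (triangle n))) (*-assoc _ _ _))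

    T-σ : ∀ f → T (σ f) ≋ σ (T f)
    T-σ f n = x∙yz≈y∙xz _ _ _

    σ-tail : ∀ f → tail (σ f) ≋ r · σ (tail f)
    σ-tail f n = *-assoc _ _ _

    opaque
      unfolding _⊛_

      σ-⊛ : ∀ f g → σ (f ⊛ g) ≋ σ f ⊛ σ g
      σ-⊛ f g zero    = begin
        1# * (f 0 * g 0 + 0#)             ≈⟨ *-identityˡ _ ⟩
        f 0 * g 0 + 0#                    ≈⟨ +-congʳ (*-cong (*-identityˡ _) (*-identityˡ _)) ⟨
        1# * f 0 * (1# * g 0) + 0#        ∎
        where open ≈-Reasoning
      σ-⊛ f g (suc n) = begin
        r ^ suc n * (f 0 * g (suc n) + (tail f ⊛ g) n)
          ≈⟨ distribˡ _ _ _ ⟩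
        r ^ suc n * (f 0 * g (suc n)) + r ^ suc n * (tail f ⊛ g) n
          ≈⟨ +-cong (x∙yz≈y∙xz _ _ _) (*-assoc _ _ _) ⟩
        f 0 * σ g (suc n) + r * (r ^ n * (tail f ⊛ g) n)
          ≈⟨ +-cong (*-congʳ (sym (*-identityˡ _))) (*-congˡ (σ-⊛ (tail f) g n)) ⟩
        σ f 0 * σ g (suc n) + r * (σ (tail f) ⊛ σ g) n
          ≈⟨ +-congˡ (·-⊛ r (σ (tail f)) (σ g) n) ⟨
        σ f 0 * σ g (suc n) + ((r · σ (tail f)) ⊛ σ g) n
          ≈⟨ +-congˡ (⊛-cong {tail (σ f)} {r · σ (tail f)} {σ g} (σ-tail f) (λ _ → refl) n) ⟨
        (σ f ⊛ σ g) (suc n)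
          ∎
        where open ≈-Reasoning

    open RingIdentities.System commutativeRing X (const r) σ
      (⊙-cong (r ^_)) (⊙-⊕ (r ^_)) (⊙-const (r ^_) r) σ-X public

    open Triangular T (⊙-cong _) (⊙-⊕ _) (⊙-const _ r) T-X T-σ public

    σ-cong[] : ∀ {f g n} → f ≋[ n ] g → σ f ≋[ n ] σ g
    σ-cong[] = ⊙-cong[] (r ^_)

    u-cong[] : ∀ {f g n} → f ≋[ n ] g → u f ≋[ suc n ] u g
    u-cong[] p = X⊛-cong[] (⊛-cong[] {const r} {const r} (λ _ _ → refl) p)

    u-mono : ∀ a k → u (mono a k) ≋ mono (r * a) (suc k)
    u-mono a k = S.trans (S.*-congˡ {X} (const-mono r a k)) (X-mono (r * a) k)

    N-mono : ∀ a k → N (mono a k) ≋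
      mono a k ⊕ (mono (r * a) (1 ℕ.+ k) ⊕ mono (r * (r * a)) (2 ℕ.+ k))
               ⊕ mono (- 1# * (r * (r * (r * (r * a))))) (3 ℕ.+ k)
    N-mono a k = S.+-cong (S.+-congˡ {mono a k} (S.+-cong (u-mono a k) uu))
      (S.trans (S.*-cong -1≋ (S.trans (S.*-congˡ {const r} (S.trans (S.*-congˡ {X} (S.*-congˡ {const r} uu))
                                          (u-mono (r * (r * a)) (2 ℕ.+ k))))
                                      (const-mono r _ (3 ℕ.+ k))))
               (const-mono (- 1#) _ (3 ℕ.+ k)))
      where
      uu : u (u (mono a k)) ≋ mono (r * (r * a)) (2 ℕ.+ k)
      uu = S.trans (S.*-congˡ {X} (S.*-congˡ {const r} (u-mono a k))) (u-mono (r * a) (suc k))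
      -1≋ : S.- S.1# ≋ const (- 1#)
      -1≋ zero    = refl
      -1≋ (suc n) = -0#≈0#

    TN : Series → Series
    TN f = T (N f)

    TN-⊕ : ∀ f g → TN (f ⊕ g) ≋ TN f ⊕ TN g
    TN-⊕ f g = S.trans (⊙-cong _ (N-+ f g)) (⊙-⊕ _ (N f) (N g))

    TN-0 : TN (λ _ → 0#) ≋ (λ _ → 0#)
    TN-0 n = trans (⊙-cong (λ n → r ^ triangle n) N-0# n) (zeroʳ _)

    TN-mono-coefficient : ∀ a k n → TN (mono a k) n ≈
      let w = λ i → r ^ triangle i ; y = λ i → (X ^ˢ i) n in
      w k * a * y k + (w (1 ℕ.+ k) * (r * a) * y (1 ℕ.+ k) + w (2 ℕ.+ k) * (r * (r * a)) * y (2 ℕ.+ k))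
        + w (3 ℕ.+ k) * (- 1# * (r * (r * (r * (r * a))))) * y (3 ℕ.+ k)
    TN-mono-coefficient a k n = trans (⊙-cong w (N-mono a k) n)
      (trans (⊙-⊕ w (mono a k ⊕ m₁₂) (mono (- 1# * (r * (r * (r * (r * a))))) (3 ℕ.+ k)) n) (+-cong
        (trans (⊙-⊕ w (mono a k) m₁₂ n) (+-cong (each a k)
          (trans (⊙-⊕ w (mono (r * a) (1 ℕ.+ k)) (mono (r * (r * a)) (2 ℕ.+ k)) n) (+-cong (each _ (1 ℕ.+ k)) (each _ (2 ℕ.+ k))))))
        (each _ (3 ℕ.+ k))))
      where
      w m₁₂ : Series
      w i = r ^ triangle i
      m₁₂ = mono (r * a) (1 ℕ.+ k) ⊕ mono (r * (r * a)) (2 ℕ.+ k)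
      each : ∀ b j → (w ⊙ mono b j) n ≈ w j * b * (X ^ˢ j) n
      each b j = trans (⊙-mono w b j n) (mono-coefficient (w j * b) j n)

    ≋[]-weaken : ∀ {f g n} → f ≋[ suc n ] g → f ≋[ n ] g
    ≋[]-weaken p m m<n = p m (ℕ.m<n⇒m<1+n m<n)

    TN-cong[] : ∀ {f g n} → f ≋[ n ] g → TN f ≋[ n ] TN g
    TN-cong[] {f} {g} p = ⊙-cong[] (λ n → r ^ triangle n) {N f} {N g} (⊕-cong[] (⊕-cong[] p (⊕-cong[] up uup))
      (⊛-cong[] {S.- S.1#} {S.- S.1#} (λ _ _ → refl) (⊛-cong[] {const r} {const r} (λ _ _ → refl) (≋[]-weaken (u-cong[] uup)))))
      where
      up  = ≋[]-weaken (u-cong[] p)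
      uup = ≋[]-weaken (u-cong[] up)

    Y-cong[] : ∀ {f g n} → f ≋[ n ] g → Y f ≋[ suc n ] Y g
    Y-cong[] p = σ-cong[] (u-cong[] (≋[]-weaken (u-cong[] (σ-cong[] (≋[]-weaken (u-cong[] (σ-cong[] p)))))))

    b₁-cong[] : ∀ {f g n} → f ≋[ n ] g → b₁ f ≋[ n ] b₁ g
    b₁-cong[] p = ⊕-cong[] p (≋[]-weaken (u-cong[] (σ-cong[] (⊕-cong[] p (≋[]-weaken (u-cong[] (σ-cong[] p)))))))

    module Uniqueness
      (affine-unique : ∀ n {a b} c → a ≈ r ^ suc n * a + c → b ≈ r ^ suc n * b + c → a ≈ b)
      {f v f′ v′ : Series} (sol : IsSolution f v) (sol′ : IsSolution f′ v′) (f₀≈f′₀ : f 0 ≈ f′ 0)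
      where

      -- The part of W that only involves lower coefficients
      W′ : Series → Series → Series
      W′ g w = σ (u (σ (b₁ g))) ⊕ σ (u (u (σ w)))

      W′-cong[] : ∀ {g g′ w w′ n} → g ≋[ n ] g′ → w ≋[ n ] w′ → W′ g w ≋[ suc n ] W′ g′ w′
      W′-cong[] p q = ⊕-cong[] (σ-cong[] (u-cong[] (σ-cong[] (b₁-cong[] p))))
                               (σ-cong[] (u-cong[] (≋[]-weaken (u-cong[] (σ-cong[] q)))))

      -- Inserting the second equation into the first leaves σ g, which contributes r^n g n, and
      -- terms that contain u and so see only lower coefficients.
      coefficient : ∀ {g w} → IsSolution g w → ∀ n → g n ≈ r ^ n * g n + (W′ g w n + Y g n)
      coefficient (g-eq , w-eq) n = trans (g-eq n) (trans (+-congʳ (w-eq n)) (+-assoc _ _ _))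

      agree : ∀ n → f ≋[ n ] f′ → v ≋[ n ] v′ → f n ≈ f′ n
      -- At degree 0 the equation only says f 0 = f 0, so the initial value has to be supplied.
      agree zero    p q = f₀≈f′₀
      agree (suc n) p q = affine-unique n (W′ f v (suc n) + Y f (suc n)) (coefficient sol (suc n))
        (trans (coefficient sol′ (suc n))
          (+-congˡ (+-cong (sym (W′-cong[] p q (suc n) ℕ.≤-refl)) (sym (Y-cong[] p (suc n) ℕ.≤-refl)))))

      ≋[]-extend : ∀ {g g′ n} → g ≋[ n ] g′ → g n ≈ g′ n → g ≋[ suc n ] g′
      ≋[]-extend p e m m<1+n with ℕ.m≤n⇒m<n∨m≡n (s≤s⁻¹ m<1+n)
      ... | inj₁ m<n    = p m m<n
      ... | inj₂ ≡.refl = e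

      -- The first unknown is extended before the second, because coefficient n of v depends on
      -- coefficient n of f through the summand σ f of `W`.
      agree[] : ∀ n → f ≋[ n ] f′ × v ≋[ n ] v′
      agree[] zero    = (λ _ ()) , (λ _ ())
      agree[] (suc n) with p , q ← agree[] n = p′ , λ m m<1+n →
        trans (sol .proj₂ m)
          (trans (⊕-cong[] (σ-cong[] p′) (W′-cong[] p q) m m<1+n) (sym (sol′ .proj₂ m)))
        where
        p′ : f ≋[ suc n ] f′
        p′ = ≋[]-extend (agree[] n .proj₁) (agree n (agree[] n .proj₁) (agree[] n .proj₂))

      unique : f ≋ f′ × v ≋ v′
      unique = ≋[]⇒≋ (λ n → agree[] n .proj₁) , ≋[]⇒≋ (λ n → agree[] n .proj₂)

-- The automaton of forbidden prefixes

module Partitions where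

  open ListAction using (sum)
  open import Data.Nat using (_+_)
  open ≡

  Pattern : Set
  Pattern = List ℕ

  _isPrefixOf_ : List ℕ → List ℕ → Set
  _isPrefixOf_ = Prefix _≡_

  HasPrefix : List Pattern → List ℕ → Set
  HasPrefix F π = Any (_isPrefixOf π) F

  -- The translation invariant forbidden patterns are  i ∷ map (i +_) τ  for τ ∈ tails.
  tails : List Pattern
  tails = (0 ∷ 0 ∷ [])
        ∷ (1 ∷ 1 ∷ [])
        ∷ (0 ∷ 1 ∷ 2 ∷ [])
        ∷ (1 ∷ 2 ∷ 3 ∷ [])
        ∷ (0 ∷ 2 ∷ 2 ∷ 3 ∷ [])
        ∷ []

  -- The shift i ranges over all naturals, 0 included, which makes the condition compatible with
  -- lowering all parts by one. Partitions have no part 0, so i = 0 forbids nothing in them.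
  Avoids : List ℕ → Set
  Avoids π = ∀ {τ} i → τ ∈ tails → ¬ ((i ∷ map (i +_) τ) isSubPartitionOf π)

  -- A state of the automaton is a list F of patterns that must not be prefixes.
  Admissible : List Pattern → List ℕ → Set
  Admissible F π = IsPartition π × Avoids π × ¬ HasPrefix F π

  -- The residual of a pattern once a part 1 has been read, as a list of at most one pattern: the
  -- empty list if the pattern can no longer occur, `[] ∷ []` if it has occurred completely.
  afterOne : Pattern → List Pattern
  afterOne []      = [] ∷ []
  afterOne (1 ∷ ρ) = ρ ∷ []
  afterOne (_ ∷ _) = []

  -- A pattern with an entry below 2 yields nothing: it cannot be a prefix of a raised partition,
  -- whose parts are all at least 2.
  lower : Pattern → List Pattern
  lower []                = [] ∷ []
  lower (suc (suc p) ∷ ρ) = map (suc p ∷_) (lower ρ)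
  lower (_ ∷ _)           = []

  -- A placed 1 also opens the instance i = 1 of every translation invariant pattern; what remains
  -- of it is τ raised by one.
  place skip : List Pattern → List Pattern
  place F = concatMap afterOne F ++ map (map suc) tails
  skip F  = concatMap lower F

  afterOne⁺ : ∀ {π} ρ → ρ isPrefixOf (1 ∷ π) → HasPrefix (afterOne ρ) π
  afterOne⁺ []      _          = here []
  afterOne⁺ (1 ∷ ρ) (refl ∷ p) = here p

  afterOne⁻ : ∀ {π} ρ → HasPrefix (afterOne ρ) π → ρ isPrefixOf (1 ∷ π)
  afterOne⁻ []      _        = []
  afterOne⁻ (1 ∷ ρ) (here p) = refl ∷ p

  lower⁺ : ∀ {π} ρ → All (1 ≤_) π → ρ isPrefixOf map suc π → HasPrefix (lower ρ) π
  lower⁺                 []      _           _          = here []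
  lower⁺ {π = suc p ∷ π} (_ ∷ ρ) (_ ∷ 1≤π) (refl ∷ pre) =
    Any.map⁺ (Any.map (refl ∷_) (lower⁺ ρ 1≤π pre))

  lower⁻ : ∀ {π} ρ → HasPrefix (lower ρ) π → ρ isPrefixOf map suc π
  lower⁻ []                _   = []
  lower⁻ (suc (suc p) ∷ ρ) has with find (Any.map⁻ has)
  ... | ρ′ , ρ′∈ , refl ∷ pre = refl ∷ lower⁻ ρ (lose ρ′∈ pre)

  1∷-isPartition⁺ : ∀ {π} → IsPartition π → IsPartition (1 ∷ π)
  1∷-isPartition⁺ {[]}    _               = ℕ.≤-refl ∷ [] , [-]
  1∷-isPartition⁺ {p ∷ π} (1≤p ∷ 1≤π , l) = ℕ.≤-refl ∷ 1≤p ∷ 1≤π , 1≤p ∷ l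

  place⁺ : ∀ {F π} → Admissible F (1 ∷ π) → Admissible (place F) π
  place⁺ {F} {π} ((_ ∷ 1≤π , l) , avoids , ¬F) = (1≤π , Linked.tail l) , (λ i τ∈ → avoids i τ∈ ∘ there) , ¬place
    where
    ¬place : ¬ HasPrefix (place F) π
    ¬place has with Any.++⁻ (concatMap afterOne F) has
    ... | inj₁ inF    = ¬F (Any.map (λ {ρ} → afterOne⁻ ρ) (Any.map⁻ (Any.concat⁻ (map afterOne F) inF)))
    ... | inj₂ inTail with _ , τ∈ , pre ← find (Any.map⁻ inTail) = avoids 1 τ∈ (here (refl ∷ pre))

  place⁻ : ∀ {F π} → Admissible (place F) π → Admissible F (1 ∷ π)
  place⁻ {F} {π} (isPartition , avoids , ¬place) = 1∷-isPartition⁺ isPartition , avoids′ , ¬F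
    where
    avoids′ : Avoids (1 ∷ π)
    avoids′ i τ∈ (here (refl ∷ pre)) = ¬place (Any.++⁺ʳ (concatMap afterOne F) (Any.map⁺ {f = map suc} (lose τ∈ pre)))
    avoids′ i τ∈ (there inf)         = avoids i τ∈ inf
    ¬F : ¬ HasPrefix F (1 ∷ π)
    ¬F has = ¬place (Any.++⁺ˡ (Any.concat⁺ (Any.map⁺ (Any.map (λ {ρ} → afterOne⁺ ρ) has))))

  prefix-pred : ∀ {ρ π} → ρ isPrefixOf map suc π → map pred ρ isPrefixOf π
  prefix-pred {π = []}    []         = []
  prefix-pred {π = p ∷ π} []         = []
  prefix-pred {π = p ∷ π} (refl ∷ r) = refl ∷ prefix-pred r

  infix-pred : ∀ {ρ π} → ρ isSubPartitionOf map suc π → map pred ρ isSubPartitionOf π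
  infix-pred {π = []}    (here p)  = here (prefix-pred {π = []} p)
  infix-pred {π = p ∷ π} (here r)  = here (prefix-pred r)
  infix-pred {π = p ∷ π} (there i) = there (infix-pred i)

  0-not-infix : ∀ {ρ π} → ¬ ((0 ∷ ρ) isSubPartitionOf map suc π)
  0-not-infix {π = []}    (here ())
  0-not-infix {π = p ∷ π} (here (() ∷ _))
  0-not-infix {π = p ∷ π} (there i) = 0-not-infix {π = π} i

  skip⁺ : ∀ {F π} → All (1 ≤_) π → Admissible F (map suc π) → Admissible (skip F) π
  skip⁺ {F} {π} 1≤π ((_ , l) , avoids , ¬F) =
    (1≤π , Linked.map s≤s⁻¹ (Linked.map⁻ l)) ,
    (λ {τ} i τ∈ inf → avoids (suc i) τ∈ (subst (_isSubPartitionOf map suc π) (cong (suc i ∷_) (sym (map-∘ τ)))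
      (Infix.map⁺ suc suc (Infix.map (cong suc) inf)))) ,
    (λ has → ¬F (Any.map (λ {ρ} → lower⁻ ρ) (Any.map⁻ (Any.concat⁻ (map lower F) has))))

  skip⁻ : ∀ {F π} → Admissible (skip F) π → Admissible F (map suc π)
  skip⁻ {F} {π} ((1≤π , l) , avoids , ¬skip) =
    (All.map⁺ (All.map (λ _ → s≤s z≤n) 1≤π) , Linked.map⁺ (Linked.map s≤s l)) ,
    avoids′ ,
    (λ has → ¬skip (Any.concat⁺ (Any.map⁺ (Any.map (λ {ρ} → lower⁺ ρ 1≤π) has))))
    where
    avoids′ : Avoids (map suc π)
    avoids′     zero    τ∈ inf = 0-not-infix {π = π} inf
    avoids′ {τ} (suc i) τ∈ inf =
      avoids i τ∈ (subst (_isSubPartitionOf π) (cong (i ∷_) (sym (map-∘ τ))) (infix-pred inf))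

  null? : (ρ : Pattern) → Dec (ρ ≡ [])
  null? []      = yes refl
  null? (_ ∷ _) = no λ ()

  dead? : ∀ F → Dec (Any (_≡ []) F)
  dead? = any? null?

  -- The admissible partitions of n into m parts, given n ≤ fuel.

  mutual
    enumerate : (fuel : ℕ) → List Pattern → (m n : ℕ) → List (List ℕ)
    enumerate k F m n with dead? F
    -- A state containing the empty pattern excludes even the empty partition.
    ... | yes _ = []
    ... | no  _ = extend k F m n

    extend : (fuel : ℕ) → List Pattern → (m n : ℕ) → List (List ℕ)
    extend k       F zero    zero    = [] ∷ []
    extend k       F zero    (suc n) = []
    extend k       F (suc m) zero    = []
    -- A default value outside the range n ≤ fuel.
    extend zero    F (suc m) (suc n) = []
    extend (suc k) F (suc m) (suc n) = map (1 ∷_) (enumerate k (place F) m n) ++ map (map suc) (skipped k F m n)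

    -- Lowering all m + 1 parts takes m + 1 away from the size n + 1; the test excludes the case in
    -- which `n ∸ m` would truncate.
    skipped : (fuel : ℕ) → List Pattern → (m n : ℕ) → List (List ℕ)
    skipped k F m n with m ≤? n
    ... | yes _ = enumerate k (skip F) (suc m) (n ∸ m)
    ... | no  _ = []

  sum-map-suc : ∀ π → sum (map suc π) ≡ length π + sum π
  sum-map-suc []      = refl
  sum-map-suc (p ∷ π) = cong suc (trans (cong (_+_ p) (sum-map-suc π)) (x∙yz≈y∙xz p (length π) (sum π)))
    where open import Algebra.Properties.CommutativeSemigroup ℕ.+-commutativeSemigroup

  Of : List Pattern → (m n : ℕ) → List ℕ → Set
  Of F m n π = Admissible F π × length π ≡ m × sum π ≡ n

  mutual
    enumerate-sound : ∀ k F m n {π} → π ∈ enumerate k F m n → Of F m n π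
    enumerate-sound k F m n π∈ with dead? F
    ... | no ¬dead = extend-sound k F m n ¬dead π∈

    extend-sound : ∀ k F m n {π} → ¬ Any (_≡ []) F → π ∈ extend k F m n → Of F m n π
    extend-sound k       F zero    zero    ¬dead (here refl) =
      (([] , []) , (λ { _ _ (here ()) }) , (λ has → ¬dead (Any.map (λ { {[]} _ → refl ; {_ ∷ _} () }) has))) , refl , refl
    extend-sound (suc k) F (suc m) (suc n) ¬dead π∈ with ∈-++⁻ (map (1 ∷_) (enumerate k (place F) m n)) π∈
    ... | inj₁ π∈ˡ with ρ , ρ∈ , refl ← ∈-map⁻ (1 ∷_) π∈ˡ
                   with adm , len , tot ← enumerate-sound k (place F) m n ρ∈
          = place⁻ adm , cong suc len , cong suc tot
    ... | inj₂ π∈ʳ with ρ , ρ∈ , refl ← ∈-map⁻ (map suc) π∈ʳ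
          = skipped-sound k F m n ρ∈

    skipped-sound : ∀ k F m n {ρ} → ρ ∈ skipped k F m n → Of F (suc m) (suc n) (map suc ρ)
    skipped-sound k F m n {ρ} ρ∈ with m ≤? n
    ... | yes m≤n with adm , len , tot ← enumerate-sound k (skip F) (suc m) (n ∸ m) ρ∈
        = skip⁻ adm , trans (length-map suc ρ) len ,
          trans (sum-map-suc ρ) (trans (cong₂ _+_ len tot) (cong suc (ℕ.m+[n∸m]≡n m≤n)))

  skipped-positive : ∀ k F m n {ρ} → ρ ∈ skipped k F m n → All (1 ≤_) ρ
  skipped-positive k F m n ρ∈ with m ≤? n
  ... | yes _ = enumerate-sound k (skip F) (suc m) (n ∸ m) ρ∈ .proj₁ .proj₁ .proj₁

  unshift : ∀ {p π} → 2 ≤ p → Linked _≤_ (p ∷ π) → ∃ λ ρ → map suc ρ ≡ p ∷ π × All (1 ≤_) ρ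
  unshift {suc p} (s≤s 1≤p) [-] = p ∷ [] , refl , 1≤p ∷ []
  unshift {suc p} (s≤s 1≤p) (p≤p′ ∷ l) with ρ , eq , 1≤ρ ← unshift (ℕ.≤-trans (s≤s 1≤p) p≤p′) l =
    p ∷ ρ , cong (suc p ∷_) eq , 1≤p ∷ 1≤ρ

  m+sum≡n : ∀ {m n} ρ → length (map suc ρ) ≡ suc m → sum (map suc ρ) ≡ suc n → m + sum ρ ≡ n
  m+sum≡n ρ len tot = ℕ.suc-injective (trans (cong (_+ sum ρ) (trans (sym len) (length-map suc ρ)))
    (trans (sym (sum-map-suc ρ)) tot))

  mutual
    enumerate-complete : ∀ k F m n {π} → n ≤ k → Of F m n π → π ∈ enumerate k F m n
    enumerate-complete k F m n {π} n≤k of with dead? F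
    ... | yes dead = contradiction (Any.map (λ { refl → [] }) dead) (of .proj₁ .proj₂ .proj₂)
    ... | no  _    = extend-complete k F m n π n≤k of

    extend-complete : ∀ k F m n π → n ≤ k → Of F m n π → π ∈ extend k F m n
    extend-complete k       F _ _ []                n≤k       (_ , refl , refl) = here refl
    extend-complete k       F _ _ (zero ∷ π)        n≤k       (((() ∷ _ , _) , _) , _)
    extend-complete (suc k) F _ _ (1 ∷ π)           (s≤s n≤k) (adm , refl , refl) =
      ∈-++⁺ˡ (∈-map⁺ (1 ∷_) (enumerate-complete k (place F) _ _ n≤k (place⁺ adm , refl , refl)))
    extend-complete (suc k) F (suc m) (suc n) (suc (suc p) ∷ π) (s≤s n≤k) of@(((_ , l) , _) , _)
      with ρ , eq , 1≤ρ ← unshift (s≤s (s≤s z≤n)) l =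
      ∈-++⁺ʳ (map (1 ∷_) (enumerate k (place F) m n))
        (subst (_∈ map (map suc) (skipped k F m n)) eq
          (∈-map⁺ (map suc) (skipped-complete k F m n ρ n≤k 1≤ρ (subst (Of F (suc m) (suc n)) (sym eq) of))))

    skipped-complete : ∀ k F m n ρ → n ≤ k → All (1 ≤_) ρ → Of F (suc m) (suc n) (map suc ρ) → ρ ∈ skipped k F m n
    skipped-complete k F m n ρ n≤k 1≤ρ (adm , len , tot) with m ≤? n
    ... | yes m≤n = enumerate-complete k (skip F) (suc m) (n ∸ m) (ℕ.≤-trans (ℕ.m∸n≤m n m) n≤k)
                      (skip⁺ 1≤ρ adm , trans (sym (length-map suc ρ)) len ,
                       ℕ.+-cancelˡ-≡ m (sum ρ) (n ∸ m) (trans (m+sum≡n ρ len tot) (sym (ℕ.m+[n∸m]≡n m≤n))))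
    ... | no  m≰n = contradiction (ℕ.m+n≤o⇒m≤o m (ℕ.≤-reflexive (m+sum≡n ρ len tot))) m≰n

  mutual
    enumerate-unique : ∀ k F m n → Unique (enumerate k F m n)
    enumerate-unique k F m n with dead? F
    ... | yes _ = []
    ... | no  _ = extend-unique k F m n

    extend-unique : ∀ k F m n → Unique (extend k F m n)
    extend-unique k       F zero    zero    = [] ∷ []
    extend-unique k       F zero    (suc n) = []
    extend-unique k       F (suc m) zero    = []
    extend-unique zero    F (suc m) (suc n) = []
    extend-unique (suc k) F (suc m) (suc n) =
      Unique.++⁺ (Unique.map⁺ ∷-injectiveʳ (enumerate-unique k (place F) m n))
                 (Unique.map⁺ (map-injective ℕ.suc-injective) (skipped-unique k F m n))
                 disjoint
      where
      disjoint : ∀ {π} → ¬ (π ∈ map (1 ∷_) (enumerate k (place F) m n) × π ∈ map (map suc) (skipped k F m n))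
      disjoint (∈ˡ , ∈ʳ) with ∈-map⁻ (1 ∷_) ∈ˡ | ∈-map⁻ (map suc) ∈ʳ
      ... | _ , _ , refl | p ∷ ρ , ρ∈ , eq with skipped-positive k F m n ρ∈ | ∷-injectiveˡ eq
      ...   | () ∷ _ | refl

    skipped-unique : ∀ k F m n → Unique (skipped k F m n)
    skipped-unique k F m n with m ≤? n
    ... | yes _ = enumerate-unique k (skip F) (suc m) (n ∸ m)
    ... | no  _ = []

  mutual
    -- A skip lowers the size by m + 1 but the fuel only by one, so recursive calls carry surplus
    -- fuel, whereas `count` uses exactly n.
    enumerate-fuel : ∀ {k k′ n} F m → n ≤ k → n ≤ k′ → enumerate k F m n ≡ enumerate k′ F m n
    enumerate-fuel F m n≤k n≤k′ with dead? F
    ... | yes _ = refl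
    ... | no  _ = extend-fuel F m n≤k n≤k′

    extend-fuel : ∀ {k k′ n} F m → n ≤ k → n ≤ k′ → extend k F m n ≡ extend k′ F m n
    extend-fuel {n = zero}  F zero    _         _          = refl
    extend-fuel {n = zero}  F (suc m) _         _          = refl
    extend-fuel {n = suc n} F zero    _         _          = refl
    extend-fuel {n = suc n} F (suc m) (s≤s n≤k) (s≤s n≤k′) =
      cong₂ (λ πs ρs → map (1 ∷_) πs ++ map (map suc) ρs)
        (enumerate-fuel (place F) m n≤k n≤k′) (skipped-fuel F m n≤k n≤k′)

    skipped-fuel : ∀ {k k′ n} F m → n ≤ k → n ≤ k′ → skipped k F m n ≡ skipped k′ F m n
    skipped-fuel {n = n} F m n≤k n≤k′ with m ≤? n
    ... | yes _ = enumerate-fuel (skip F) (suc m) (ℕ.≤-trans (ℕ.m∸n≤m n m) n≤k) (ℕ.≤-trans (ℕ.m∸n≤m n m) n≤k′)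
    ... | no  _ = refl

  count : List Pattern → ℤ⟦x,q⟧
  count F m n = ℤ.+ length (enumerate n F m n)

  Alive : List Pattern → Set
  Alive F = ¬ Any (_≡ []) F

  enumerate-alive : ∀ {F} → Alive F → ∀ k m n → enumerate k F m n ≡ extend k F m n
  enumerate-alive {F} alive k m n with dead? F
  ... | yes dead = contradiction dead alive
  ... | no  _    = refl

  count-dead : ∀ {F} → Any (_≡ []) F → ∀ m n → count F m n ≡ 0ℤ
  count-dead {F} dead m n with dead? F
  ... | yes _    = refl
  ... | no alive = contradiction dead alive

  count-zero : ∀ {F} → Alive F → ∀ n → count F 0 n ≡ 1q n
  count-zero alive zero    rewrite enumerate-alive alive 0 0 0 = refl
  count-zero alive (suc n) rewrite enumerate-alive alive (suc n) 0 (suc n) = refl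

  count-suc-zero : ∀ {F} → Alive F → ∀ m → count F (suc m) 0 ≡ 0ℤ
  count-suc-zero alive m rewrite enumerate-alive alive 0 (suc m) 0 = refl

  count-suc-suc : ∀ {F} → Alive F → ∀ m n →
    count F (suc m) (suc n) ≡ count (place F) m n ℤ.+ ℤ.+ length (skipped n F m n)
  count-suc-suc {F} alive m n rewrite enumerate-alive alive (suc n) (suc m) (suc n) =
    cong ℤ.+_ (trans (length-++ (map (1 ∷_) (enumerate n (place F) m n)))
      (cong₂ _+_ (length-map (1 ∷_) (enumerate n (place F) m n)) (length-map (map suc) (skipped n F m n))))

  skipped-≤ : ∀ F {m n} → m ≤ n → ℤ.+ length (skipped n F m n) ≡ count (skip F) (suc m) (n ∸ m)
  skipped-≤ F {m} {n} m≤n with m ≤? n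
  ... | yes _   = cong (ℤ.+_ ∘ length) (enumerate-fuel (skip F) (suc m) (ℕ.m∸n≤m n m) ℕ.≤-refl)
  ... | no  m≰n = contradiction m≤n m≰n

  skipped-> : ∀ F {m n} → n < m → ℤ.+ length (skipped n F m n) ≡ 0ℤ
  skipped-> F {m} {n} n<m with m ≤? n
  ... | yes m≤n = contradiction n<m (ℕ.≤⇒≯ m≤n)
  ... | no  _   = refl

  -- The forbidden patterns 1+1, 1+2+3, 2+2+3 amount to forbidden prefixes.
  initial : List Pattern
  initial = (1 ∷ 1 ∷ []) ∷ (1 ∷ 2 ∷ 3 ∷ []) ∷ (2 ∷ 2 ∷ 3 ∷ []) ∷ []

  translate : ∀ {i τ} → 1 ≤ i → τ ∈ tails → Forbidden (i ∷ map (i +_) τ)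
  translate {i} 1≤i (here refl) =
    subst (λ j → Forbidden (i ∷ j ∷ j ∷ [])) (sym (ℕ.+-identityʳ i)) (i+i+i 1≤i)
  translate {i} 1≤i (there (here refl)) = i+[i+1]+[i+1] 1≤i
  translate {i} 1≤i (there (there (here refl))) =
    subst (λ j → Forbidden (i ∷ j ∷ i + 1 ∷ i + 2 ∷ [])) (sym (ℕ.+-identityʳ i)) (i+i+[i+1]+[i+2] 1≤i)
  translate {i} 1≤i (there (there (there (here refl)))) = i+[i+1]+[i+2]+[i+3] 1≤i
  translate {i} 1≤i (there (there (there (there (here refl))))) =
    subst (λ j → Forbidden (i ∷ j ∷ i + 2 ∷ i + 2 ∷ i + 3 ∷ [])) (sym (ℕ.+-identityʳ i)) (i+i+[i+2]+[i+2]+[i+3] 1≤i)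

  data InitialOrTranslate (ρ : List ℕ) : Set where
    isInitial   : ρ ∈ initial → InitialOrTranslate ρ
    isTranslate : ∀ {τ} i → τ ∈ tails → ρ ≡ i ∷ map (i +_) τ → InitialOrTranslate ρ

  classify : ∀ {ρ} → Forbidden ρ → InitialOrTranslate ρ
  classify 1+1                        = isInitial (here refl)
  classify 1+2+3                      = isInitial (there (here refl))
  classify 2+2+3                      = isInitial (there (there (here refl)))
  classify (i+i+i {i} _)              = isTranslate i (here refl)
    (cong (λ j → i ∷ j ∷ j ∷ []) (sym (ℕ.+-identityʳ i)))
  classify (i+[i+1]+[i+1] {i} _)      = isTranslate i (there (here refl)) refl
  classify (i+i+[i+1]+[i+2] {i} _)    = isTranslate i (there (there (here refl)))
    (cong (λ j → i ∷ j ∷ i + 1 ∷ i + 2 ∷ []) (sym (ℕ.+-identityʳ i)))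
  classify (i+[i+1]+[i+2]+[i+3] {i} _) = isTranslate i (there (there (there (here refl)))) refl
  classify (i+i+[i+2]+[i+2]+[i+3] {i} _) = isTranslate i (there (there (there (there (here refl)))))
    (cong (λ j → i ∷ j ∷ i + 2 ∷ i + 2 ∷ i + 3 ∷ []) (sym (ℕ.+-identityʳ i)))

  -- The part before an initial pattern is 1 or 2 by monotonicity. Either 1+1 or 1+2+3 is then a
  -- prefix (1,1 and 1,1,2,3 already begin with 1+1), or, for 2+2+3, a translation invariant pattern
  -- appears: 1+2+2 or 2+2+2.
  initial-∷ : ∀ {p π} → IsPartition (p ∷ π) → Avoids (p ∷ π) → HasPrefix initial π → HasPrefix initial (p ∷ π)
  initial-∷ {0}     (() ∷ _ , _) _ _
  initial-∷ {1}     _ _      (here (refl ∷ _))         = here (refl ∷ refl ∷ [])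
  initial-∷ {1}     _ _      (there (here (refl ∷ _))) = here (refl ∷ refl ∷ [])
  initial-∷ {1}     _ avoids (there (there (here (refl ∷ refl ∷ _)))) =
    contradiction (here (refl ∷ refl ∷ refl ∷ [])) (avoids 1 (there (here refl)))
  initial-∷ {2}     _ avoids (there (there (here (refl ∷ refl ∷ _)))) =
    contradiction (here (refl ∷ refl ∷ refl ∷ [])) (avoids 2 (here refl))
  initial-∷ {suc (suc p)}       (_ , s≤s () ∷ _)       _ (here (refl ∷ _))
  initial-∷ {suc (suc p)}       (_ , s≤s () ∷ _)       _ (there (here (refl ∷ _)))
  initial-∷ {suc (suc (suc p))} (_ , s≤s (s≤s ()) ∷ _) _ (there (there (here (refl ∷ _))))

  initial-prefix : ∀ {ρ π} → IsPartition π → Avoids π → ρ ∈ initial → ρ isSubPartitionOf π → HasPrefix initial π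
  initial-prefix _ _ ρ∈ (here pre) = lose ρ∈ pre
  initial-prefix isPartition@(_ ∷ 1≤π , l) avoids ρ∈ (there inf) =
    initial-∷ isPartition avoids (initial-prefix (1≤π , Linked.tail l) (λ i τ∈ → avoids i τ∈ ∘ there) ρ∈ inf)

  infix-head : ∀ {i ρ π} → All (1 ≤_) π → (i ∷ ρ) isSubPartitionOf π → 1 ≤ i
  infix-head (1≤p ∷ _)   (here (refl ∷ _)) = 1≤p
  infix-head (_ ∷ 1≤π)   (there inf)       = infix-head 1≤π inf

  forbidden-initial : ∀ {ρ} → ρ ∈ initial → Forbidden ρ
  forbidden-initial (here refl)                 = 1+1
  forbidden-initial (there (here refl))         = 1+2+3
  forbidden-initial (there (there (here refl))) = 2+2+3

  𝒫⇒admissible : ∀ {π} → 𝒫 π → Admissible initial π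
  𝒫⇒admissible (isPartition@(1≤π , _) , avoids) =
    isPartition ,
    (λ i τ∈ inf → avoids _ (translate (infix-head 1≤π inf) τ∈) inf) ,
    (λ has → let _ , ρ∈ , pre = find has in avoids _ (forbidden-initial ρ∈) (here pre))

  admissible⇒𝒫 : ∀ {π} → Admissible initial π → 𝒫 π
  admissible⇒𝒫 {π} (isPartition , avoids , ¬initial) = isPartition , λ ρ forbidden inf → no-infix (classify forbidden) inf
    where
    no-infix : ∀ {ρ} → InitialOrTranslate ρ → ¬ (ρ isSubPartitionOf π)
    no-infix (isInitial ρ∈)          inf = ¬initial (initial-prefix isPartition avoids ρ∈ inf)
    no-infix (isTranslate i τ∈ refl) inf = avoids i τ∈ inf

  weight-self : ∀ {m n} π → length π ≡ m → sum π ≡ n → weight π m n ≡ 1ℤ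
  weight-self π refl refl rewrite ℕ.≟-diag {length π} refl | ℕ.≟-diag {sum π} refl = refl

  weight-nonzero : ∀ {m n} π → weight π m n ≢ 0ℤ → length π ≡ m × sum π ≡ n
  weight-nonzero {m} {n} π ≢0 with m ≟ length π | n ≟ sum π
  ... | yes m≡ | yes n≡ = sym m≡ , sym n≡
  ... | yes _  | no  _  = contradiction refl ≢0
  ... | no  _  | _      = contradiction refl ≢0

  𝒫-hasSum : HasSum 𝒫 weight (count initial)
  𝒫-hasSum m n =
    enumerate n initial m n ,
    enumerate-unique n initial m n ,
    All.tabulate (λ π∈ → admissible⇒𝒫 (enumerate-sound n initial m n π∈ .proj₁)) ,
    (λ π π∈𝒫 ≢0 → enumerate-complete n initial m n ℕ.≤-refl (𝒫⇒admissible π∈𝒫 , weight-nonzero π ≢0)) ,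
    total (All.tabulate (λ {π} π∈ → let _ , len , tot = enumerate-sound n initial m n π∈ in weight-self π len tot))
    where
    total : ∀ {πs} → All (λ π → weight π m n ≡ 1ℤ) πs → foldr ℤ._+_ 0ℤ (map (λ π → weight π m n) πs) ≡ ℤ.+ length πs
    total []       = refl
    total (w ∷ ws) = cong₂ ℤ._+_ w (total ws)

-- Generating functions of the states

open Partitions
open ≡ using (refl; sym; trans; cong; cong₂; module ≡-Reasoning)
open AbelianGroupProperties ℤ.+-0-abelianGroup using (xyx⁻¹≈y)

module Q = PowerSeries ℤ.+-*-commutativeRing
module XQ = PowerSeries Q.commutativeRing
open XQ using (_≋_; _⊕_; _⊛_; const; X; mono; _≋[_]_)
open Exp Q.S.commutativeSemiring using (_^_; ^-homo-*; ^-assocʳ)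
open Exp XQ.S.commutativeSemiring using () renaming (_^_ to _^ˢ_)

r : ℤ⟦q⟧
r = Q.X

open XQ.Dilation r

-- At x^(m+1), σ multiplies by q^(m+1), which is the size lost when m + 1 parts are lowered by one.
-- For n < m both sides vanish.
skip-coefficient : ∀ F m n → (r ^ suc m Q.⊛ count (skip F) (suc m)) (suc n) ≡ ℤ.+ length (skipped n F m n)
skip-coefficient F m n with ℕ.<-≤-connex n m
... | inj₁ n<m = trans (Q.X^⊛-< (count (skip F) (suc m)) (s≤s n<m)) (sym (skipped-> F n<m))
... | inj₂ m≤n = trans
  (cong (r ^ suc m Q.⊛ count (skip F) (suc m)) (cong suc (sym (ℕ.m+[n∸m]≡n m≤n))))
  (trans (Q.X^⊛-+ (count (skip F) (suc m)) (suc m) (n ∸ m)) (sym (skipped-≤ F m≤n)))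

-- Partitions split by whether the first part is 1. At x^0 the empty partition has to be counted on
-- both sides, hence the two conditions that states are alive; for concrete states they hold by
-- evaluation.
count-step : ∀ F {_ : False (dead? F)} {_ : False (dead? (skip F))} →
  count F ≋ u (count (place F)) ⊕ σ (count (skip F))
count-step F {alive} {skip-alive} zero n =
  trans (count-zero (toWitnessFalse alive) n) (sym (begin
    u (count (place F)) 0 n ℤ.+ σ (count (skip F)) 0 n
      ≡⟨ cong₂ ℤ._+_ (XQ.X⊛-zero (const r ⊛ count (place F)) n) (Q.⊛-identityˡ (count (skip F) 0) n) ⟩
    0ℤ ℤ.+ count (skip F) 0 n
      ≡⟨ ℤ.+-identityˡ _ ⟩
    count (skip F) 0 n
      ≡⟨ count-zero (toWitnessFalse skip-alive) n ⟩
    1q n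
      ∎))
  where open ≡-Reasoning
count-step F {alive} (suc m) n =
  trans (coefficient n) (cong (ℤ._+ σ (count (skip F)) (suc m) n) (sym
    (trans (XQ.X⊛-suc (const r ⊛ count (place F)) m n) (XQ.const-⊛ r (count (place F)) m n))))
  where
  coefficient : ∀ n → count F (suc m) n ≡ (r Q.⊛ count (place F) m) n ℤ.+ σ (count (skip F)) (suc m) n
  coefficient zero    = trans (count-suc-zero (toWitnessFalse alive) m) (sym (cong₂ ℤ._+_
    (Q.X⊛-zero (count (place F) m)) (Q.X^⊛-< (count (skip F) (suc m)) {suc m} {0} (s≤s ℕ.z≤n))))
  coefficient (suc n) = trans (count-suc-suc (toWitnessFalse alive) m n) (sym (cong₂ ℤ._+_
    (Q.X⊛-suc (count (place F) m) n) (skip-coefficient F m n)))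

count-skip : ∀ F {_ : False (dead? F)} {_ : False (dead? (skip F))} {_ : True (dead? (place F))} →
  count F ≋ σ (count (skip F))
count-skip F {alive} {skip-alive} {dead} = XQ.S.trans (count-step F {alive} {skip-alive})
  (XQ.S.trans (XQ.S.+-congʳ (XQ.S.trans (u-cong (count-dead (toWitness dead)))
                 (XQ.S.trans (XQ.S.*-congˡ {X} (XQ.S.zeroʳ (const r))) (XQ.S.zeroʳ X))))
    (XQ.S.+-identityˡ _))

-- All states reachable from `[]` and `initial` without dying. The automaton closes by evaluation:
-- `skip` sends `A`, `B₁`, `B₂`, `B₃` and `D` to `A`, `D₁` to `B₁`, and `C′` and `initial` to `D`;
-- `place` sends `C` to `B₂′` and `initial` to `B₁′`.
A A₁ A₂ B₁ B₁′ B₂ B₂′ B₃ C C′ D D₁ D₂ : List Pattern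
A   = []
A₁  = place A
A₂  = place A₁
B₁  = skip A₁
B₁′ = place B₁
B₂  = skip B₁′
B₂′ = place B₂
B₃  = skip B₂′
C   = skip A₂
D   = skip C
D₁  = place D
D₂  = place D₁
C′  = skip D₂

module Counts = Automaton
  (count A) (count A₁) (count A₂) (count B₁) (count B₁′) (count B₂) (count B₂′) (count B₃)
  (count C) (count C′) (count D) (count D₁) (count D₂) (count initial)
  (count-step A) (count-step A₁) (count-skip A₂) (count-step B₁) (count-skip B₁′)
  (count-step B₂) (count-skip B₂′) (count-skip B₃) (count-step C) (count-skip C′)
  (count-step D) (count-step D₁) (count-skip D₂) (count-step initial)

-- Inverses, q-Pochhammer symbols and Euler series

opaque
  unfolding Q._⊛_

  *q≋⊛ : ∀ {f f′ g g′} → f Q.≋ f′ → g Q.≋ g′ → f *q g Q.≋ f′ Q.⊛ g′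
  *q≋⊛ = Q.⊛-cong

1q≋ : 1q Q.≋ Q.S.1#
1q≋ zero    = refl
1q≋ (suc n) = refl

q≋ : q Q.≋ r
q≋ 0             = refl
q≋ 1             = refl
q≋ (suc (suc n)) = refl

^q≋ : ∀ {f g} → f Q.≋ g → ∀ k → f ^q k Q.≋ g ^ k
^q≋ p zero    = 1q≋
^q≋ p (suc k) = *q≋⊛ p (^q≋ p k)

q^≋ : ∀ k → q ^q k Q.≋ r ^ k
q^≋ = ^q≋ q≋

*-inverse : ∀ f → f 0 ≡ 1ℤ → f Q.⊛ f ⁻¹ Q.≋ Q.S.1#
*-inverse f f0 = Q.S.trans (Q.S.sym (*q≋⊛ {f} {f} {f ⁻¹} {f ⁻¹} Q.S.refl Q.S.refl)) (Q.S.trans (*-inverseʳ f f0) 1q≋)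

⁻¹-unique : ∀ f g → f 0 ≡ 1ℤ → f Q.⊛ g Q.≋ Q.S.1# → f ⁻¹ Q.≋ g
⁻¹-unique f g f0 fg≋1 = begin
  f ⁻¹                      ≈⟨ Q.S.*-identityʳ (f ⁻¹) ⟨
  f ⁻¹ Q.⊛ Q.S.1#           ≈⟨ Q.S.*-congˡ {f ⁻¹} fg≋1 ⟨
  f ⁻¹ Q.⊛ (f Q.⊛ g)        ≈⟨ Q.S.*-assoc (f ⁻¹) f g ⟨
  f ⁻¹ Q.⊛ f Q.⊛ g          ≈⟨ Q.S.*-congʳ (Q.S.trans (Q.S.*-comm (f ⁻¹) f) (*-inverse f f0)) ⟩
  Q.S.1# Q.⊛ g              ≈⟨ Q.S.*-identityˡ g ⟩
  g                         ∎
  where open Q.≋-Reasoning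

*q-0 : ∀ f g → f 0 ≡ 1ℤ → g 0 ≡ 1ℤ → (f *q g) 0 ≡ 1ℤ
*q-0 f g f0 g0 rewrite f0 | g0 = refl

⁻¹-* : ∀ f g → f 0 ≡ 1ℤ → g 0 ≡ 1ℤ → (f *q g) ⁻¹ Q.≋ f ⁻¹ Q.⊛ g ⁻¹
⁻¹-* f g f0 g0 = ⁻¹-unique (f *q g) (f ⁻¹ Q.⊛ g ⁻¹) (*q-0 f g f0 g0) (begin
  f *q g Q.⊛ (f ⁻¹ Q.⊛ g ⁻¹)      ≈⟨ Q.S.*-congʳ {f ⁻¹ Q.⊛ g ⁻¹} (*q≋⊛ {f} {f} {g} {g} Q.S.refl Q.S.refl) ⟩
  f Q.⊛ g Q.⊛ (f ⁻¹ Q.⊛ g ⁻¹)     ≈⟨ interchange f g (f ⁻¹) (g ⁻¹) ⟩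
  f Q.⊛ f ⁻¹ Q.⊛ (g Q.⊛ g ⁻¹)     ≈⟨ Q.S.*-cong (*-inverse f f0) (*-inverse g g0) ⟩
  Q.S.1# Q.⊛ Q.S.1#               ≈⟨ Q.S.*-identityˡ Q.S.1# ⟩
  Q.S.1#                          ∎)
  where
  open Q.≋-Reasoning
  open CommutativeSemigroupProperties Q.S.*-commutativeSemigroup using (interchange)

module Pochhammer (t-1 : ℕ) (a : ℤ⟦q⟧) (a≋ : a Q.≋ r ^ suc t-1) where

  t : ℕ
  t = suc t-1

  factor : ℕ → ℤ⟦q⟧
  factor j = 1q -q a *q a ^q j

  factor≋ : ∀ j → factor j Q.≋ Q.S.1# Q.S.- r ^ (suc j ℕ.* t)
  factor≋ j = Q.S.+-cong 1q≋ (Q.S.-‿cong (begin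
    a *q a ^q j              ≈⟨ *q≋⊛ a≋ (^q≋ a≋ j) ⟩
    (r ^ t) ^ suc j          ≈⟨ ^-assocʳ r t (suc j) ⟩
    r ^ (t ℕ.* suc j)        ≡⟨ cong (r ^_) (ℕ.*-comm t (suc j)) ⟩
    r ^ (suc j ℕ.* t)        ∎))
    where open Q.≋-Reasoning

  factor-0 : ∀ j → factor j 0 ≡ 1ℤ
  factor-0 j = trans (factor≋ j 0) (cong (λ z → 1ℤ ℤ.- z) (Q.X⊛-zero (r ^ (t-1 ℕ.+ j ℕ.* t))))

  poch-0 : ∀ j → qPoch a a j 0 ≡ 1ℤ
  poch-0 zero    = refl
  poch-0 (suc j) = *q-0 (qPoch a a j) (factor j) (poch-0 j) (factor-0 j)

  inv : ℕ → ℤ⟦q⟧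
  inv j = qPoch a a j ⁻¹

  -- Multiply 1 = q^((j+1)t) + `factor` j by the inverse of the longer product; its last factor
  -- cancels in the second term.
  inv-suc : ∀ j → inv (suc j) Q.≋ r ^ (suc j ℕ.* t) Q.⊛ inv (suc j) Q.⊕ inv j
  inv-suc j = begin
    inv (suc j)
      ≈⟨ Q.S.*-identityˡ (inv (suc j)) ⟨
    Q.S.1# Q.⊛ inv (suc j)
      ≈⟨ Q.S.*-congʳ 1≋ ⟩
    (r ^ (suc j ℕ.* t) Q.⊕ factor j) Q.⊛ inv (suc j)
      ≈⟨ Q.S.distribʳ (inv (suc j)) (r ^ (suc j ℕ.* t)) (factor j) ⟩
    r ^ (suc j ℕ.* t) Q.⊛ inv (suc j) Q.⊕ factor j Q.⊛ inv (suc j)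
      ≈⟨ Q.S.+-congˡ {r ^ (suc j ℕ.* t) Q.⊛ inv (suc j)} cancel ⟩
    r ^ (suc j ℕ.* t) Q.⊛ inv (suc j) Q.⊕ inv j
      ∎
    where
    open Q.≋-Reasoning
    1≋ : Q.S.1# Q.≋ r ^ (suc j ℕ.* t) Q.⊕ factor j
    1≋ n = sym (trans (cong (ℤ._+_ ((r ^ (suc j ℕ.* t)) n)) (factor≋ j n)) (x+y-x≡y ((r ^ (suc j ℕ.* t)) n) (Q.S.1# n)))
      where
      x+y-x≡y : ∀ x y → x ℤ.+ (y ℤ.- x) ≡ y
      x+y-x≡y x y = trans (sym (ℤ.+-assoc x y (ℤ.- x))) (xyx⁻¹≈y x y)
    cancel : factor j Q.⊛ inv (suc j) Q.≋ inv j
    cancel = begin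
      factor j Q.⊛ inv (suc j)
        ≈⟨ Q.S.*-congˡ {factor j} (⁻¹-* (qPoch a a j) (factor j) (poch-0 j) (factor-0 j)) ⟩
      factor j Q.⊛ (inv j Q.⊛ factor j ⁻¹)
        ≈⟨ CommutativeSemigroupProperties.x∙yz≈y∙xz Q.S.*-commutativeSemigroup (factor j) (inv j) (factor j ⁻¹) ⟩
      inv j Q.⊛ (factor j Q.⊛ factor j ⁻¹)
        ≈⟨ Q.S.*-congˡ {inv j} (*-inverse (factor j) (factor-0 j)) ⟩
      inv j Q.⊛ Q.S.1#
        ≈⟨ Q.S.*-identityʳ (inv j) ⟩
      inv j
        ∎

  inv-zero : inv 0 Q.≋ Q.S.1#
  inv-zero = ⁻¹-unique 1q Q.S.1# refl (Q.S.trans (Q.S.*-identityʳ 1q) 1q≋)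

  open XQ.Stretch t-1 using (stretch; stretch-recurrence; stretch-zero; ⊙-stretch; stretch-cong)

  -- ∑ⱼ q^(s j) x^(t j) / (q^t; q^t)ⱼ
  coefficient : ℕ → XQ.Series
  coefficient s j = r ^ (s ℕ.* j) Q.⊛ inv j

  series : ℕ → XQ.Series
  series s = stretch (coefficient s)

  coefficient-zero : ∀ s → coefficient s 0 Q.≋ Q.S.1#
  coefficient-zero s = begin
    r ^ (s ℕ.* 0) Q.⊛ inv 0    ≡⟨ cong (λ e → r ^ e Q.⊛ inv 0) (ℕ.*-zeroʳ s) ⟩
    Q.S.1# Q.⊛ inv 0           ≈⟨ Q.S.*-identityˡ (inv 0) ⟩
    inv 0                      ≈⟨ inv-zero ⟩
    Q.S.1#                     ∎
    where open Q.≋-Reasoning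

  -- Euler's series for the reciprocal of (x^t q^s; q^t)_∞, characterised by (1 - x^t q^s) f(x) =
  -- f(xq). Coefficientwise this is `inv-suc` times q^(s(j+1)).
  series-equation : ∀ s → series s ≋ σ (series s) ⊕ X ^ˢ t ⊛ (const r ^ˢ s ⊛ series s)
  series-equation s = XQ.S.trans
    (stretch-recurrence {coefficient s} {(λ i → r ^ (i ℕ.* t)) XQ.⊙ coefficient s} (r ^ s) (coefficient s)
      (Q.S.sym (Q.S.*-identityˡ (coefficient s 0))) recurrence)
    (XQ.S.+-cong (XQ.S.sym (⊙-stretch (r ^_) (coefficient s))) (XQ.S.*-congˡ {X ^ˢ t} (XQ.S.*-congʳ {series s} (XQ.const-^ r s))))
    where
    open Q.≋-Reasoning
    recurrence : ∀ j → coefficient s (suc j) Q.≋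
                 r ^ (suc j ℕ.* t) Q.⊛ coefficient s (suc j) Q.⊕ r ^ s Q.⊛ coefficient s j
    recurrence j = begin
      r ^ (s ℕ.* suc j) Q.⊛ inv (suc j)
        ≈⟨ Q.S.*-congˡ {r ^ (s ℕ.* suc j)} (inv-suc j) ⟩
      r ^ (s ℕ.* suc j) Q.⊛ (r ^ (suc j ℕ.* t) Q.⊛ inv (suc j) Q.⊕ inv j)
        ≈⟨ Q.S.distribˡ (r ^ (s ℕ.* suc j)) (r ^ (suc j ℕ.* t) Q.⊛ inv (suc j)) (inv j) ⟩
      r ^ (s ℕ.* suc j) Q.⊛ (r ^ (suc j ℕ.* t) Q.⊛ inv (suc j)) Q.⊕ r ^ (s ℕ.* suc j) Q.⊛ inv j
        ≈⟨ Q.S.+-cong (CommutativeSemigroupProperties.x∙yz≈y∙xz Q.S.*-commutativeSemigroup (r ^ (s ℕ.* suc j)) (r ^ (suc j ℕ.* t)) (inv (suc j)))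
             (Q.S.trans (Q.S.*-congʳ (Q.S.trans (Q.S.reflexive (cong (r ^_) (ℕ.*-suc s j))) (^-homo-* r s (s ℕ.* j))))
                        (Q.S.*-assoc (r ^ s) (r ^ (s ℕ.* j)) (inv j))) ⟩
      r ^ (suc j ℕ.* t) Q.⊛ coefficient s (suc j) Q.⊕ r ^ s Q.⊛ coefficient s j
        ∎

module P₁ = Pochhammer 0 q (Q.S.trans q≋ (Q.S.sym (Q.S.*-identityʳ r)))
module P₂ = Pochhammer 1 (q ^q 2) (q^≋ 2)
module P₃ = Pochhammer 2 (q ^q 3) (q^≋ 3)
module P₄ = Pochhammer 3 (q ^q 4) (q^≋ 4)

module S₄ = XQ.Stretch 3

sign : ℕ → ℤ⟦q⟧
sign l = Q.const (-1ℤ ℤ.^ l)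

-- Euler's expansion of (z; p)_∞ has coefficients (-1)^l p^(l(l-1)/2) / (p; p)_l. For p = q⁴ and z =
-- x⁴q⁸ the exponent of q is 2l(l-1) + 8l = 2l² + 6l.
δ-coefficient : XQ.Series
δ-coefficient l = sign l Q.⊛ (r ^ (2 ℕ.* l ℕ.^ 2 ℕ.+ 6 ℕ.* l) Q.⊛ P₄.inv l)

α β γ δ : XQ.Series
α = P₁.series 2
β = P₂.series 3
γ = P₃.series 4
δ = S₄.stretch δ-coefficient

sign-suc : ∀ l → sign (suc l) Q.⊕ sign l Q.≋ Q.S.0#
sign-suc l zero    = trans (cong (ℤ._+ (-1ℤ ℤ.^ l)) (ℤ.-1*i≡-i (-1ℤ ℤ.^ l))) (ℤ.+-inverseˡ (-1ℤ ℤ.^ l))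
sign-suc l (suc n) = refl

δ-recurrence : ∀ l → r ^ (suc l ℕ.* 4) Q.⊛ δ-coefficient (suc l) Q.≋
               δ-coefficient (suc l) Q.⊕ r ^ 8 Q.⊛ (r ^ (l ℕ.* 4) Q.⊛ δ-coefficient l)
δ-recurrence l = RingIdentities.alternating-step Q.commutativeRing (r ^ 8) (r ^ (l ℕ.* 4))
  (sign-suc l) (P₄.inv-suc l) (begin
    r ^ (2 ℕ.* suc l ℕ.^ 2 ℕ.+ 6 ℕ.* suc l)
      ≡⟨ cong (r ^_) (exponent l) ⟩
    r ^ (8 ℕ.+ (l ℕ.* 4 ℕ.+ (2 ℕ.* l ℕ.^ 2 ℕ.+ 6 ℕ.* l)))
      ≈⟨ ^-homo-* r 8 (l ℕ.* 4 ℕ.+ (2 ℕ.* l ℕ.^ 2 ℕ.+ 6 ℕ.* l)) ⟩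
    r ^ 8 Q.⊛ r ^ (l ℕ.* 4 ℕ.+ (2 ℕ.* l ℕ.^ 2 ℕ.+ 6 ℕ.* l))
      ≈⟨ Q.S.*-congˡ {r ^ 8} (^-homo-* r (l ℕ.* 4) (2 ℕ.* l ℕ.^ 2 ℕ.+ 6 ℕ.* l)) ⟩
    r ^ 8 Q.⊛ (r ^ (l ℕ.* 4) Q.⊛ r ^ (2 ℕ.* l ℕ.^ 2 ℕ.+ 6 ℕ.* l))
      ∎)
  where
  open Q.≋-Reasoning
  exponent : ∀ l → 2 ℕ.* (suc l ℕ.* (suc l ℕ.* 1)) ℕ.+ 6 ℕ.* suc l
                   ≡ 8 ℕ.+ (l ℕ.* 4 ℕ.+ (2 ℕ.* (l ℕ.* (l ℕ.* 1)) ℕ.+ 6 ℕ.* l))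
  exponent = solve-∀

σδ≋ : σ δ ≋ S₄.stretch ((λ i → r ^ (i ℕ.* 4)) XQ.⊙ δ-coefficient)
σδ≋ = S₄.⊙-stretch (r ^_) δ-coefficient

-- This is δ = (1 - x⁴q⁸) σ δ with the negative term moved across, as the semiring computations
-- require.
δ-equation : σ δ ≋ δ ⊕ X ^ˢ 4 ⊛ (const r ^ˢ 8 ⊛ σ δ)
δ-equation = XQ.S.trans σδ≋ (XQ.S.trans
  (S₄.stretch-recurrence {(λ i → r ^ (i ℕ.* 4)) XQ.⊙ δ-coefficient} {δ-coefficient} (r ^ 8)
    ((λ i → r ^ (i ℕ.* 4)) XQ.⊙ δ-coefficient) (Q.S.*-identityˡ (δ-coefficient 0)) δ-recurrence)
  (XQ.S.+-congˡ {δ} (XQ.S.*-congˡ {X ^ˢ 4} (XQ.S.*-cong (XQ.const-^ r 8) (XQ.S.sym σδ≋)))))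

module Solution = Product σ-⊛ α β γ δ
  (P₁.series-equation 2) (P₂.series-equation 3) (P₃.series-equation 4) δ-equation
open Solution using (H; Z)

⊛-coefficient-one : ∀ f g → f 0 Q.≋ Q.S.1# → g 0 Q.≋ Q.S.1# → (f ⊛ g) 0 Q.≋ Q.S.1#
⊛-coefficient-one f g f0 g0 = Q.S.trans (XQ.⊛-coefficient-zero f g)
  (Q.S.trans (Q.S.*-cong f0 g0) (Q.S.*-identityˡ Q.S.1#))

H-zero : H 0 Q.≋ Q.S.1#
H-zero = ⊛-coefficient-one (α ⊛ β ⊛ γ) δ (⊛-coefficient-one (α ⊛ β) γ (⊛-coefficient-one α β
    (series-zero 0 (P₁.coefficient 2) (P₁.coefficient-zero 2))
    (series-zero 1 (P₂.coefficient 3) (P₂.coefficient-zero 3)))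
    (series-zero 2 (P₃.coefficient 4) (P₃.coefficient-zero 4)))
  (series-zero 3 δ-coefficient (Q.S.trans (Q.S.*-cong {sign 0} {Q.S.1#} sign-zero
      (Q.S.trans (Q.S.*-identityˡ (P₄.inv 0)) P₄.inv-zero)) (Q.S.*-identityˡ Q.S.1#)))
  where
  series-zero : ∀ t-1 d → d 0 Q.≋ Q.S.1# → XQ.Stretch.stretch t-1 d 0 Q.≋ Q.S.1#
  series-zero t-1 d d0 = Q.S.trans (XQ.Stretch.stretch-zero t-1 d) d0
  sign-zero : sign 0 Q.≋ Q.S.1#
  sign-zero zero    = refl
  sign-zero (suc n) = refl

-- The factor 1 - q^(n+1) can be cancelled: the equation is a contraction in q.
affine-unique : ∀ n {a b} c → a Q.≋ r ^ suc n Q.⊛ a Q.⊕ c → b Q.≋ r ^ suc n Q.⊛ b Q.⊕ c → a Q.≋ b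
affine-unique n {a} {b} c a-eq b-eq = Q.X⊛-affine-unique (r ^ n) c
  (Q.S.trans a-eq (Q.S.+-congʳ {c} (Q.S.*-assoc r (r ^ n) a)))
  (Q.S.trans b-eq (Q.S.+-congʳ {c} (Q.S.*-assoc r (r ^ n) b)))

σA-zero : σ (count A) 0 Q.≋ T H 0
σA-zero = Q.S.trans (Q.S.*-identityˡ (count A 0)) (Q.S.trans (λ n → trans (count-zero {A} (λ ()) n) (1q≋ n))
  (Q.S.sym (Q.S.trans (Q.S.*-identityˡ (H 0)) H-zero)))

module Comparison = Uniqueness affine-unique Counts.isSolution Solution.isSolution σA-zero

count-initial≋TN : count initial ≋ TN H
count-initial≋TN = XQ.S.trans Counts.I≈ (XQ.S.trans
  (XQ.S.+-cong (u-cong (⊙-cong′ (b₂-cong (Comparison.unique .proj₁)))) (Comparison.unique .proj₂))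
  Solution.uσb₂+T≈TN)
  where
  ⊙-cong′ : ∀ {f g} → f ≋ g → σ f ≋ σ g
  ⊙-cong′ = XQ.⊙-cong (r ^_)

-- Expansion into the quadruple sum

Index : Set
Index = ℕ × ℕ × ℕ × ℕ

box : ℕ → List Index
box n = cartesianProduct (upTo n) (cartesianProduct (upTo n) (cartesianProduct (upTo n) (upTo n)))

term₁ term₂ term₃ term₄ : ℕ → XQ.Series
term₁ i = mono (P₁.coefficient 2 i) (i ℕ.* 1)
term₂ j = mono (P₂.coefficient 3 j) (j ℕ.* 2)
term₃ k = mono (P₃.coefficient 4 k) (k ℕ.* 3)
term₄ l = mono (δ-coefficient l) (l ℕ.* 4)

term : Index → XQ.Series
term (i , j , k , l) = term₁ i ⊛ (term₂ j ⊛ (term₃ k ⊛ term₄ l))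

open ListSum XQ.commutativeRing using (∑ᴸ; ∑ᴸ-*; ∑ᴸ-cong; ∑ᴸ-homo)

-- Each of the four series is exact below x^n after n terms. The box also yields terms of degree n
-- and more, which the congruence ignores.
H≋[]box : ∀ n → H ≋[ n ] ∑ᴸ term (box n)
H≋[]box n = XQ.≋[]-trans (XQ.≋⇒≋[] reassociate)
  (XQ.≋[]-trans (XQ.⊛-cong[] (series≋[] 0 (P₁.coefficient 2)) (XQ.⊛-cong[] (series≋[] 1 (P₂.coefficient 3))
      (XQ.⊛-cong[] (series≋[] 2 (P₃.coefficient 4)) (series≋[] 3 δ-coefficient))))
    (XQ.≋⇒≋[] product))
  where
  reassociate : H ≋ α ⊛ (β ⊛ (γ ⊛ δ))
  reassociate = XQ.S.trans (XQ.S.*-assoc (α ⊛ β) γ δ) (XQ.S.*-assoc α β (γ ⊛ δ))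

  series≋[] : ∀ t-1 d → XQ.Stretch.stretch t-1 d ≋[ n ] ∑ᴸ (λ i → mono (d i) (i ℕ.* suc t-1)) (upTo n)
  series≋[] t-1 d = XQ.≋[]-trans (XQ.Stretch.stretch≋[] t-1 d n) (XQ.≋⇒≋[] (XQ.Stretch.truncated-∑ᴸ t-1 d n))

  product : ∑ᴸ term₁ (upTo n) ⊛ (∑ᴸ term₂ (upTo n) ⊛ (∑ᴸ term₃ (upTo n) ⊛ ∑ᴸ term₄ (upTo n))) ≋ ∑ᴸ term (box n)
  product = XQ.S.trans
    (XQ.S.*-congˡ {∑ᴸ term₁ (upTo n)} (XQ.S.trans
      (XQ.S.*-congˡ {∑ᴸ term₂ (upTo n)} (∑ᴸ-* term₃ term₄ (upTo n) (upTo n)))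
      (∑ᴸ-* term₂ (λ (k , l) → term₃ k ⊛ term₄ l) (upTo n) _)))
    (∑ᴸ-* term₁ (λ (j , k , l) → term₂ j ⊛ (term₃ k ⊛ term₄ l)) (upTo n) _)

M L : Index → ℕ
M (i , j , k , l) = i ℕ.+ 2 ℕ.* j ℕ.+ 3 ℕ.* k ℕ.+ 4 ℕ.* l
L (i , j , k , l) = 2 ℕ.* l ℕ.^ 2 ℕ.+ 2 ℕ.* i ℕ.+ 3 ℕ.* j ℕ.+ 4 ℕ.* k ℕ.+ 6 ℕ.* l

denominator : Index → ℤ⟦q⟧
denominator (i , j , k , l) =
     qPoch q q i
  *q qPoch (q ^q 2) (q ^q 2) j
  *q qPoch (q ^q 3) (q ^q 3) k
  *q qPoch (q ^q 4) (q ^q 4) l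

-- The coefficient of x^M that a quadruple contributes to H; the powers q^(n(n-1)/2) are added only
-- by T.
amplitude : Index → ℤ⟦q⟧
amplitude v@(_ , _ , _ , l) = sign l Q.⊛ (r ^ L v Q.⊛ denominator v ⁻¹)

term≋mono : ∀ v → term v ≋ mono (amplitude v) (M v)
term≋mono v@(i , j , k , l) = begin
  term₁ i ⊛ (term₂ j ⊛ (term₃ k ⊛ term₄ l))
    ≈⟨ XQ.S.*-congˡ {term₁ i} (XQ.S.trans
         (XQ.S.*-congˡ {term₂ j} (XQ.mono-⊛ c₃ (k ℕ.* 3) c₄ (l ℕ.* 4)))
         (XQ.mono-⊛ c₂ (j ℕ.* 2) (c₃ Q.⊛ c₄) (k ℕ.* 3 ℕ.+ l ℕ.* 4))) ⟩
  term₁ i ⊛ mono (c₂ Q.⊛ (c₃ Q.⊛ c₄)) (j ℕ.* 2 ℕ.+ (k ℕ.* 3 ℕ.+ l ℕ.* 4))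
    ≈⟨ XQ.mono-⊛ c₁ (i ℕ.* 1) (c₂ Q.⊛ (c₃ Q.⊛ c₄)) _ ⟩
  mono (c₁ Q.⊛ (c₂ Q.⊛ (c₃ Q.⊛ c₄))) (i ℕ.* 1 ℕ.+ (j ℕ.* 2 ℕ.+ (k ℕ.* 3 ℕ.+ l ℕ.* 4)))
    ≡⟨ cong (mono (c₁ Q.⊛ (c₂ Q.⊛ (c₃ Q.⊛ c₄)))) (x-exponent i j k l) ⟩
  mono (c₁ Q.⊛ (c₂ Q.⊛ (c₃ Q.⊛ c₄))) (M v)
    ≈⟨ XQ.mono-cong (M v) amplitude≋ ⟩
  mono (amplitude v) (M v)
    ∎
  where
  c₁ c₂ c₃ c₄ p₁ p₂ p₃ p₄ : ℤ⟦q⟧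
  c₁ = P₁.coefficient 2 i
  c₂ = P₂.coefficient 3 j
  c₃ = P₃.coefficient 4 k
  c₄ = δ-coefficient l
  p₁ = qPoch q q i
  p₂ = qPoch (q ^q 2) (q ^q 2) j
  p₃ = qPoch (q ^q 3) (q ^q 3) k
  p₄ = qPoch (q ^q 4) (q ^q 4) l
  x-exponent : ∀ i j k l → i ℕ.* 1 ℕ.+ (j ℕ.* 2 ℕ.+ (k ℕ.* 3 ℕ.+ l ℕ.* 4)) ≡ i ℕ.+ 2 ℕ.* j ℕ.+ 3 ℕ.* k ℕ.+ 4 ℕ.* l
  x-exponent = solve-∀
  q-exponent : ∀ i j k l s → 2 ℕ.* i ℕ.+ (3 ℕ.* j ℕ.+ (4 ℕ.* k ℕ.+ (2 ℕ.* s ℕ.+ 6 ℕ.* l)))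
                             ≡ 2 ℕ.* s ℕ.+ 2 ℕ.* i ℕ.+ 3 ℕ.* j ℕ.+ 4 ℕ.* k ℕ.+ 6 ℕ.* l
  q-exponent = solve-∀
  open XQ.≋-Reasoning
  inverse≋ : denominator v ⁻¹ Q.≋ p₁ ⁻¹ Q.⊛ p₂ ⁻¹ Q.⊛ p₃ ⁻¹ Q.⊛ p₄ ⁻¹
  inverse≋ = Q.S.trans
    (⁻¹-* (p₁ *q p₂ *q p₃) p₄ (*q-0 (p₁ *q p₂) p₃ (*q-0 p₁ p₂ (P₁.poch-0 i) (P₂.poch-0 j)) (P₃.poch-0 k)) (P₄.poch-0 l))
    (Q.S.*-congʳ {p₄ ⁻¹} (Q.S.trans
      (⁻¹-* (p₁ *q p₂) p₃ (*q-0 p₁ p₂ (P₁.poch-0 i) (P₂.poch-0 j)) (P₃.poch-0 k))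
      (Q.S.*-congʳ {p₃ ⁻¹} (⁻¹-* p₁ p₂ (P₁.poch-0 i) (P₂.poch-0 j)))))
  power≋ : r ^ L v Q.≋ r ^ (2 ℕ.* i) Q.⊛ (r ^ (3 ℕ.* j) Q.⊛ (r ^ (4 ℕ.* k) Q.⊛ r ^ (2 ℕ.* l ℕ.^ 2 ℕ.+ 6 ℕ.* l)))
  power≋ = Q.S.trans (Q.S.reflexive (cong (r ^_) (sym (q-exponent i j k l (l ℕ.^ 2)))))
    (Q.S.trans (^-homo-* r (2 ℕ.* i) _) (Q.S.*-congˡ {r ^ (2 ℕ.* i)}
      (Q.S.trans (^-homo-* r (3 ℕ.* j) _) (Q.S.*-congˡ {r ^ (3 ℕ.* j)}
        (^-homo-* r (4 ℕ.* k) _)))))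
  amplitude≋ : c₁ Q.⊛ (c₂ Q.⊛ (c₃ Q.⊛ c₄)) Q.≋ amplitude v
  amplitude≋ = Q.S.trans
    (RingIdentities.regroup Q.commutativeRing (r ^ (2 ℕ.* i)) (p₁ ⁻¹) (r ^ (3 ℕ.* j)) (p₂ ⁻¹) (r ^ (4 ℕ.* k)) (p₃ ⁻¹)
      (sign l) (r ^ (2 ℕ.* l ℕ.^ 2 ℕ.+ 6 ℕ.* l)) (p₄ ⁻¹))
    (Q.S.*-congˡ {sign l} (Q.S.sym (Q.S.*-cong power≋ inverse≋)))

monomial : ∀ a b m → (x^ a q^ b) m Q.≋ r ^ b Q.⊛ (X ^ˢ a) m
monomial a b m = Q.S.trans pointwise (Q.S.*-congˡ {r ^ b} (Q.S.sym (XQ.X^-coefficient a m)))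
  where
  pointwise : (x^ a q^ b) m Q.≋ r ^ b Q.⊛ (if ⌊ m ≟ a ⌋ then Q.S.1# else Q.S.0#)
  pointwise n with m ≟ a
  ... | yes _ = sym (trans (Q.S.*-identityʳ (r ^ b) n) (Q.X^-coefficient b n))
  ... | no  _ = sym (Q.S.zeroʳ (r ^ b) n)

triangle-formula : ∀ k → XQ.triangle (suc k) ≡ suc k ℕ.* k ℕ./ 2
triangle-formula k = trans (sym (m*n/n≡m (XQ.triangle (suc k)) 2)) (cong (ℕ._/ 2) (doubled k))
  where
  doubled : ∀ k → XQ.triangle (suc k) ℕ.* 2 ≡ suc k ℕ.* k
  doubled zero    = refl
  doubled (suc k) = trans (ℕ.*-distribʳ-+ 2 (suc k) (XQ.triangle (suc k)))
    (trans (cong (suc k ℕ.* 2 ℕ.+_) (doubled k)) (arithmetic k))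
    where
    arithmetic : ∀ k → suc k ℕ.* 2 ℕ.+ suc k ℕ.* k ≡ suc (suc k) ℕ.* suc k
    arithmetic = solve-∀

triangle-formula′ : ∀ k → XQ.triangle k ≡ k ℕ.* (k ∸ 1) ℕ./ 2
triangle-formula′ zero    = refl
triangle-formula′ (suc k) = triangle-formula k

-- `N` spreads x^M over the exponents M to M + 3, with extra factors 1, q, q² and -q⁴; T then
-- supplies q^(n(n-1)/2) at each of these four exponents n.
summand≋TN : ∀ v → summand v ≋ TN (term v)
summand≋TN v@(i , j , k , l) m = begin
  summand v m
    ≈⟨ Q.const-⊛ (-1ℤ ℤ.^ l) _ ⟨
  sign l Q.⊛ (numerator m *q denominator v ⁻¹)
    ≈⟨ Q.S.*-congˡ {sign l} (*q≋⊛ numerator≋ (Q.S.refl {denominator v ⁻¹})) ⟩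
  sign l Q.⊛ ((w 0 Q.⊛ ℓ Q.⊛ y 0 Q.⊕ w 1 Q.⊛ (ℓ Q.⊛ r) Q.⊛ y 1 Q.⊕ w 2 Q.⊛ (ℓ Q.⊛ (r Q.⊛ r)) Q.⊛ y 2
      Q.S.- w 3 Q.⊛ (ℓ Q.⊛ (r Q.⊛ (r Q.⊛ (r Q.⊛ r)))) Q.⊛ y 3) Q.⊛ denominator v ⁻¹)
    ≈⟨ RingIdentities.numerator-expansion Q.commutativeRing (sign l) ℓ (denominator v ⁻¹) r
         (w 0) (w 1) (w 2) (w 3) (y 0) (y 1) (y 2) (y 3) ⟩
  _
    ≈⟨ TN-mono-coefficient (amplitude v) (M v) m ⟨
  TN (mono (amplitude v) (M v)) m
    ≈⟨ TN-cong (term≋mono v) m ⟨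
  TN (term v) m
    ∎
  where
  open Q.≋-Reasoning
  TN-cong : ∀ {f g} → f ≋ g → TN f ≋ TN g
  TN-cong p = XQ.⊙-cong (λ n → r ^ XQ.triangle n) (N-cong p)
  ℓ : ℤ⟦q⟧
  ℓ = r ^ L v
  w y : ℕ → ℤ⟦q⟧
  w e = r ^ XQ.triangle (e ℕ.+ M v)
  y e = (X ^ˢ (e ℕ.+ M v)) m
  numerator : ℤ⟦x,q⟧
  numerator =
         x^ M v         q^ (M v ℕ.* (M v ∸ 1) ℕ./ 2 ℕ.+ L v)
    +xq  x^ M v ℕ.+ 1 q^ ((M v ℕ.+ 1) ℕ.* M v ℕ./ 2 ℕ.+ L v ℕ.+ 1)
    +xq  x^ M v ℕ.+ 2 q^ ((M v ℕ.+ 2) ℕ.* (M v ℕ.+ 1) ℕ./ 2 ℕ.+ L v ℕ.+ 2)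
    -xq  x^ M v ℕ.+ 3 q^ ((M v ℕ.+ 3) ℕ.* (M v ℕ.+ 2) ℕ./ 2 ℕ.+ L v ℕ.+ 4)

  shifted : ∀ a b e c → a ≡ e ℕ.+ M v → b ≡ XQ.triangle (e ℕ.+ M v) ℕ.+ L v ℕ.+ c →
            (x^ a q^ b) m Q.≋ w e Q.⊛ (ℓ Q.⊛ r ^ c) Q.⊛ y e
  shifted _ _ e c refl refl = Q.S.trans (monomial (e ℕ.+ M v) _ m) (Q.S.*-congʳ {y e} (begin
    r ^ (XQ.triangle (e ℕ.+ M v) ℕ.+ L v ℕ.+ c)     ≡⟨ cong (r ^_) (ℕ.+-assoc (XQ.triangle (e ℕ.+ M v)) (L v) c) ⟩
    r ^ (XQ.triangle (e ℕ.+ M v) ℕ.+ (L v ℕ.+ c))   ≈⟨ ^-homo-* r (XQ.triangle (e ℕ.+ M v)) (L v ℕ.+ c) ⟩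
    w e Q.⊛ r ^ (L v ℕ.+ c)                         ≈⟨ Q.S.*-congˡ {w e} (^-homo-* r (L v) c) ⟩
    w e Q.⊛ (ℓ Q.⊛ r ^ c)                           ∎))

  +1 : M v ℕ.+ 1 ≡ suc (M v)
  +1 = ℕ.+-comm (M v) 1
  +2 : M v ℕ.+ 2 ≡ suc (M v ℕ.+ 1)
  +2 = ℕ.+-suc (M v) 1
  +3 : M v ℕ.+ 3 ≡ suc (M v ℕ.+ 2)
  +3 = ℕ.+-suc (M v) 2

  triangle≡ : ∀ {a b} e → a ≡ e ℕ.+ M v → a ≡ suc b → a ℕ.* b ℕ./ 2 ≡ XQ.triangle (e ℕ.+ M v)
  triangle≡ {b = b} e eq refl = trans (sym (triangle-formula b)) (cong XQ.triangle eq)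

  numerator≋ : numerator m Q.≋
    w 0 Q.⊛ ℓ Q.⊛ y 0 Q.⊕ w 1 Q.⊛ (ℓ Q.⊛ r) Q.⊛ y 1 Q.⊕ w 2 Q.⊛ (ℓ Q.⊛ (r Q.⊛ r)) Q.⊛ y 2
      Q.S.- w 3 Q.⊛ (ℓ Q.⊛ (r Q.⊛ (r Q.⊛ (r Q.⊛ r)))) Q.⊛ y 3
  numerator≋ = Q.S.+-cong (Q.S.+-cong (Q.S.+-cong
    (Q.S.trans (monomial (M v) _ m) (Q.S.*-congʳ {y 0} (Q.S.trans
      (Q.S.reflexive (cong (λ e → r ^ (e ℕ.+ L v)) (sym (triangle-formula′ (M v)))))
      (^-homo-* r (XQ.triangle (M v)) (L v)))))
    (Q.S.trans (shifted _ _ 1 1 +1 (cong (λ e → e ℕ.+ L v ℕ.+ 1) (triangle≡ 1 +1 +1)))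
      (tidy 1 r (Q.S.*-identityʳ r))))
    (Q.S.trans (shifted _ _ 2 2 (ℕ.+-comm (M v) 2) (cong (λ e → e ℕ.+ L v ℕ.+ 2) (triangle≡ 2 (ℕ.+-comm (M v) 2) +2)))
      (tidy 2 _ (Q.S.*-congˡ {r} (Q.S.*-identityʳ r)))))
    (Q.S.-‿cong (Q.S.trans (shifted _ _ 3 4 (ℕ.+-comm (M v) 3) (cong (λ e → e ℕ.+ L v ℕ.+ 4) (triangle≡ 3 (ℕ.+-comm (M v) 3) +3)))
      (tidy 3 _ (Q.S.*-congˡ {r} (Q.S.*-congˡ {r} (Q.S.*-congˡ {r} (Q.S.*-identityʳ r)))))))
    where
    tidy : ∀ e {c} c′ → c Q.≋ c′ → w e Q.⊛ (ℓ Q.⊛ c) Q.⊛ y e Q.≋ w e Q.⊛ (ℓ Q.⊛ c′) Q.⊛ y e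
    tidy e c′ p = Q.S.*-congʳ {y e} (Q.S.*-congˡ {w e} (Q.S.*-congˡ {ℓ} p))

summand-< : ∀ v m → m < M v → summand v m Q.≋ Q.S.0#
summand-< v m m<M = Q.S.trans (summand≋TN v m) (XQ.≋[]-trans {TN (term v)}
  (TN-cong[] (XQ.≋[]-trans {term v} (XQ.≋⇒≋[] (term≋mono v)) (XQ.mono-≋[] (amplitude v) (M v))))
  (XQ.≋⇒≋[] TN-0) m m<M)

index≤M : ∀ {i j k l m} → M (i , j , k , l) ≤ m → i ≤ m × j ≤ m × k ≤ m × l ≤ m
index≤M {i} {j} {k} {l} M≤m =
  ℕ.≤-trans (ℕ.m≤m+n i (2 ℕ.* j)) ij ,
  ℕ.≤-trans (ℕ.m≤m+n j _) (ℕ.≤-trans (ℕ.m≤n+m (2 ℕ.* j) i) ij) ,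
  ℕ.≤-trans (ℕ.m≤m+n k _) (ℕ.≤-trans (ℕ.m≤n+m (3 ℕ.* k) (i ℕ.+ 2 ℕ.* j)) ijk) ,
  ℕ.≤-trans (ℕ.m≤m+n l _) (ℕ.≤-trans (ℕ.m≤n+m (4 ℕ.* l) (i ℕ.+ 2 ℕ.* j ℕ.+ 3 ℕ.* k)) M≤m)
  where
  ijk = ℕ.≤-trans (ℕ.m≤m+n (i ℕ.+ 2 ℕ.* j ℕ.+ 3 ℕ.* k) (4 ℕ.* l)) M≤m
  ij  = ℕ.≤-trans (ℕ.m≤m+n (i ℕ.+ 2 ℕ.* j) (3 ℕ.* k)) ijk

∈-box : ∀ {v m} → M v ≤ m → v ∈ box (suc m)
∈-box {v} M≤m with i≤ , j≤ , k≤ , l≤ ← index≤M M≤m =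
  ∈-cartesianProduct⁺ (∈-upTo⁺ (s≤s i≤)) (∈-cartesianProduct⁺ (∈-upTo⁺ (s≤s j≤))
    (∈-cartesianProduct⁺ (∈-upTo⁺ (s≤s k≤)) (∈-upTo⁺ (s≤s l≤))))

summand-sum : ∀ m n → foldr ℤ._+_ 0ℤ (map (λ v → summand v m n) (box (suc m))) ≡ count initial m n
summand-sum m n = begin
  foldr ℤ._+_ 0ℤ (map (λ v → summand v m n) (box (suc m)))
    ≡⟨ Q.∑ᴸ-coefficient (λ v → summand v m) n (box (suc m)) ⟨
  foldr Q._⊕_ Q.S.0# (map (λ v → summand v m) (box (suc m))) n
    ≡⟨ cong (λ f → f n) (XQ.∑ᴸ-coefficient summand m (box (suc m))) ⟨
  ∑ᴸ summand (box (suc m)) m n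
    ≡⟨ ∑ᴸ-cong summand≋TN (box (suc m)) m n ⟩
  ∑ᴸ (λ v → TN (term v)) (box (suc m)) m n
    ≡⟨ ∑ᴸ-homo TN TN-0 TN-⊕ term (box (suc m)) m n ⟨
  TN (∑ᴸ term (box (suc m))) m n
    -- `TN` never lowers the degree in x, so coefficient m needs H only below x^(m+1).
    ≡⟨ TN-cong[] (H≋[]box (suc m)) m ℕ.≤-refl n ⟨
  TN H m n
    ≡⟨ count-initial≋TN m n ⟨
  count initial m n
    ∎
  where open ≡-Reasoning

summand-hasSum : HasSum U summand (count initial)
summand-hasSum m n =
  box (suc m) ,
  Unique.cartesianProduct⁺ (Unique.upTo⁺ (suc m)) (Unique.cartesianProduct⁺ (Unique.upTo⁺ (suc m))
    (Unique.cartesianProduct⁺ (Unique.upTo⁺ (suc m)) (Unique.upTo⁺ (suc m)))) ,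
  All.tabulate (λ _ → _) ,
  nonzero ,
  summand-sum m n
  where
  nonzero : ∀ v → U v → summand v m n ≢ 0ℤ → v ∈ box (suc m)
  nonzero v _ ≢0 with M v ℕ.≤? m
  ... | yes M≤m = ∈-box {v} M≤m
  ... | no  M≰m = contradiction (summand-< v m (ℕ.≰⇒> M≰m) n) ≢0

mainTheorem12 : ∃ λ s → HasSum 𝒫 weight s × HasSum U summand s
mainTheorem12 = count initial , 𝒫-hasSum , summand-hasSum
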